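{- There exists a function $f(n,w,d)$ such that for every integer $n\geq 3$ and positive integers $w,d$: if $G$ is a connected graph with tree-width at most $w$, maximum degree at most $d$, and at least $f(n,w,d)$ vertices, then $G$ has a connected ring-decomposition of width at most $w$ and length at least $n$.
   Context: Graphs are finite and loopless but may have multiple edges. A ring-decomposition of $G$ of width $w$ and length $n$ ($n\ge 3$) is a cyclic sequence $(G_0,G_1,\dots,G_n)$ of subgraphs of $G$ such that: (R1) $G_0\cup G_1\cup\dots\cup G_n=G$; (R2) consecutive $G_i$ (cyclically, with $G_n$ and $G_0$ consecutive) are edge-disjoint and non-consecutive $G_i$ are vertex-disjoint; (R3) for each $i\in\{1,\dots,n+1\}$, setting $G_{n+1}=G_0$ and $W_i:=V(G_{i-1}\cap G_i)$, we have $|W_i|=w$; (R4) for each $i\in\{1,\dots,n\}$, $G_i$ contains $w$ vertex-disjoint paths between $W_i$ and $W_{i+1}$. It is connected if $G_i$ is connected for every $i\in\{1,\dots,n\}$ ($G_0$ need not be connected). -}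

module Defs where

open import Data.Nat using (ℕ; zero; suc; _≤_)
open import Data.Fin using (Fin; zero; suc; inject₁; _≟_)
open import Data.Fin.Subset using (Subset; _∈_; _∩_; ∣_∣)
open import Data.List using (List; []; _∷_; length; filter; allFin)
open import Data.List.Relation.Unary.Unique.Propositional using (Unique)
open import Data.List.Membership.Propositional renaming (_∈_ to _∈ₗ_)
open import Data.Product using (Σ; ∃; ∃₂; _×_; _,_)
open import Data.Sum using (_⊎_)
open import Data.Unit using (⊤)
open import Data.Empty using (⊥)
open import Relation.Binary.PropositionalEquality using (_≡_; _≢_)
open import Relation.Nullary using (¬_)
open import Relation.Nullary.Decidable using (_⊎-dec_)

-- Finite loopless multigraphs: vertices Fin nV, edges Fin nE, each edge
-- has two (distinct) ends.  Edges are undirected; src/tgt is just a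
-- labelling of the two ends.

record Multigraph : Set where
  field
    nV : ℕ
    nE : ℕ
    src : Fin nE → Fin nV
    tgt : Fin nE → Fin nV
    loopless : ∀ e → src e ≢ tgt e

open Multigraph public

Joins : (G : Multigraph) → Fin (nE G) → Fin (nV G) → Fin (nV G) → Set
Joins G e u v = (src G e ≡ u × tgt G e ≡ v) ⊎ (src G e ≡ v × tgt G e ≡ u)

-- degree of v: number of edges incident with v (loopless, so no double count)
degree : (G : Multigraph) → Fin (nV G) → ℕ
degree G v = length (filter (λ e → (src G e ≟ v) ⊎-dec (tgt G e ≟ v)) (allFin (nE G)))

MaxDegree≤ : Multigraph → ℕ → Set
MaxDegree≤ G d = ∀ v → degree G v ≤ d

data Walk (G : Multigraph) (P : Fin (nV G) → Set) (Q : Fin (nE G) → Set)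
     : Fin (nV G) → Fin (nV G) → List (Fin (nV G)) → List (Fin (nE G)) → Set where
  stop : ∀ {u} → P u → Walk G P Q u u (u ∷ []) []
  step : ∀ {u v w vs es} (e : Fin (nE G)) → P u → Q e → Joins G e u v →
         Walk G P Q v w vs es → Walk G P Q u w (u ∷ vs) (e ∷ es)

-- connected (Diestel convention: non-empty, and any two vertices are
-- joined by a walk inside)
ConnectedOn : (G : Multigraph) → (Fin (nV G) → Set) → (Fin (nE G) → Set) → Set
ConnectedOn G P Q =
  (∃ λ v → P v) ×
  (∀ u v → P u → P v → ∃₂ λ vs es → Walk G P Q u v vs es)

Connected : Multigraph → Set
Connected G = ConnectedOn G (λ _ → ⊤) (λ _ → ⊤)

-- a cycle: a path u … w with distinct vertices, closed by a further edge
-- e joining w and u, all edges distinct (in a multigraph two parallel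
-- edges form a cycle of length 2)
HasCycle : Multigraph → Set
HasCycle G = ∃ λ u → ∃ λ w → ∃ λ vs → ∃ λ es → ∃ λ e →
  Walk G (λ _ → ⊤) (λ _ → ⊤) u w vs es × Unique vs × Unique (e ∷ es) × Joins G e w u

IsTree : Multigraph → Set
IsTree T = Connected T × ¬ HasCycle T

record TreeDecomposition (G : Multigraph) (w : ℕ) : Set where
  field
    T : Multigraph
    isTree : IsTree T
    bag : Fin (nV T) → Subset (nV G)
    width≤ : ∀ t → ∣ bag t ∣ ≤ suc w
    coversV : ∀ v → ∃ λ t → v ∈ bag t
    coversE : ∀ e → ∃ λ t → (src G e ∈ bag t) × (tgt G e ∈ bag t)
    subtree : ∀ v → ConnectedOn T (λ t → v ∈ bag t) (λ _ → ⊤)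

TreeWidth≤ : Multigraph → ℕ → Set
TreeWidth≤ G w = TreeDecomposition G w

record Subgraph (G : Multigraph) : Set where
  field
    V : Subset (nV G)
    E : Subset (nE G)
    closed : ∀ e → e ∈ E → (src G e ∈ V) × (tgt G e ∈ V)

open Subgraph public

ConnectedSub : (G : Multigraph) → Subgraph G → Set
ConnectedSub G H = ConnectedOn G (λ v → v ∈ V H) (λ e → e ∈ E H)

PathIn : (G : Multigraph) → Subgraph G → Fin (nV G) → Fin (nV G) → List (Fin (nV G)) → Set
PathIn G H u v vs = (∃ λ es → Walk G (λ x → x ∈ V H) (λ e → e ∈ E H) u v vs es) × Unique vs

DisjointPaths : (G : Multigraph) → Subgraph G → ℕ → Subset (nV G) → Subset (nV G) → Set
DisjointPaths G H k A B =
  Σ (Fin k → Fin (nV G)) λ s → Σ (Fin k → Fin (nV G)) λ t → Σ (Fin k → List (Fin (nV G))) λ ps →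
    (∀ j → PathIn G H (s j) (t j) (ps j) × (s j ∈ A) × (t j ∈ B)) ×
    (∀ j j' → j ≢ j' → ∀ x → x ∈ₗ ps j → x ∈ₗ ps j' → ⊥)

cnext : ∀ {n} → Fin (suc n) → Fin (suc n)
cnext {zero} zero = zero
cnext {suc n} zero = suc zero
cnext {suc n} (suc i) with cnext {n} i
... | zero = zero
... | suc j = suc (suc j)

record RingDecomposition (G : Multigraph) (w n : ℕ) : Set where
  field
    n≥3 : 3 ≤ n
    part : Fin (suc n) → Subgraph G
    unionV : ∀ v → ∃ λ i → v ∈ V (part i)
    unionE : ∀ e → ∃ λ i → e ∈ E (part i)
    consecEdgeDisjoint : ∀ i e → e ∈ E (part i) → e ∈ E (part (cnext i)) → ⊥
    nonconsecVertexDisjoint : ∀ i j → i ≢ j → cnext i ≢ j → cnext j ≢ i →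
      ∀ v → v ∈ V (part i) → v ∈ V (part j) → ⊥
  -- W' i = V(G_i ∩ G_{i+1 mod n+1}) = W_{i+1}
  W' : Fin (suc n) → Subset (nV G)
  W' i = V (part i) ∩ V (part (cnext i))
  field
    sizeW : ∀ i → ∣ W' i ∣ ≡ w
    -- (R4): for i = j+1 ∈ {1,…,n}, G_i has w disjoint W_i–W_{i+1} paths
    linked : ∀ (j : Fin n) → DisjointPaths G (part (suc j)) w (W' (inject₁ j)) (W' (suc j))

ConnectedRing : ∀ {G w n} → RingDecomposition G w n → Set
ConnectedRing {G} {w} {n} R = ∀ (j : Fin n) → ConnectedSub G (RingDecomposition.part R (suc j))

{-# OPTIONS --safe #-}
module Submission where

-- Call ∂ B X the set of vertices of B outside X with a neighbour in X.
-- By repeatedly passing to a bag and a large component of what it leaves,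
-- the tree-decomposition yields a long strictly decreasing chain of
-- connected sets with at most w outside neighbours each. As degrees are
-- bounded, so are the edge cuts of these sets; after passing to an equally
-- spaced subchain, an edge crossing two consecutive sets crosses all of
-- them. Such a nested family Z is a weak ring-decomposition with
-- separators ∂ (Z 0) (Z j): the edges crossing every set only join vertices
-- of the remaining part G₀.
--
-- Induct on the order k of a long family. By Menger, either long blocks
-- each contain a separator of order below k, which together form a family
-- of smaller order, or some block is linked by k disjoint paths between any
-- two of its separators. Cut that block into n pieces. If all are connected
-- they are the parts G₁, …, Gₙ. In a disconnected piece, keep only one
-- component and move everything else into G₀: a path outside the component
-- meets every separator, so the order drops again.

open import Defs
open import Data.Nat using (ℕ; zero; suc; _+_; _*_; _≤_; _<_; z≤n; s≤s; _≤?_; _<?_)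
open import Data.Nat.Properties using (≤-refl; ≤-trans; ≤-reflexive; <-≤-trans; ≤-<-trans; <⇒≤; <-irrefl; n≤1+n; m≤m+n; m≤n+m; +-mono-≤; +-monoʳ-≤; +-monoˡ-≤; *-monoˡ-≤; +-comm; +-assoc; +-suc; +-identityʳ; ≰⇒>; ≤-pred; *-identityʳ; *-mono-≤; ≤-antisym; <-cmp; m≤n⇒m<n∨m≡n)
open import Data.Fin as Fin using (Fin; zero; suc; toℕ; fromℕ<; inject₁)
import Data.Fin.Properties as Finₚ
import Data.Fin.Subset as Subset
import Data.List.Membership.DecPropositional as DecMembership
open import Data.Fin.Subset using (Subset; _∈_; _∉_; _⊆_; _∪_; _∩_; _-_; ⁅_⁆; ∣_∣; inside; outside)
open import Data.Fin.Subset.Properties using (_∈?_; x∈⁅x⁆; x∈⁅y⁆⇒x≡y; ∣⁅x⁆∣≡1; p⊆q⇒∣p∣≤∣q∣; p⊂q⇒∣p∣<∣q∣; ∣p∣≤n; x∈p⇒∣p-x∣<∣p∣; x∈p∧x≢y⇒x∈p-y; x∈p∪q⁺; x∈p∪q⁻; x∈p∩q⁺; ∣p∩q∣≤∣p∣; x∈p∩q⁻; ∣⊥∣≡0; ∈⊤; ∣⊤∣≡n; ⊆-antisym)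
open import Data.Vec using (_∷_; []; tabulate; here; there)
open import Data.Vec.Properties using (lookup∘tabulate; lookup⇒[]=; []=⇒lookup)
open import Data.List using (List; []; _∷_; length; map; filter; concatMap; allFin)
open import Data.List.Properties using (length-map; length-filter)
open import Data.List.Membership.Propositional using (find) renaming (_∈_ to _∈ₗ_)
open import Data.List.Membership.Propositional.Properties using (∈-filter⁺; ∈-filter⁻; ∈-allFin; ∈-map⁺; ∈-map⁻; ∈-concatMap⁺; ∈-concatMap⁻)
open import Data.List.Relation.Unary.Any as Any using (here; there)
open import Data.List.Relation.Unary.All using (All; []; _∷_)
import Data.List.Relation.Unary.All.Properties as Allₚ
open import Data.List.Relation.Unary.AllPairs using ([]; _∷_)
open import Data.List.Relation.Unary.Unique.Propositional using (Unique)
open import Data.Product using (Σ; ∃; ∃₂; _×_; _,_; proj₁; proj₂)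
open import Data.Sum using (_⊎_; inj₁; inj₂; [_,_]′; map₁; map₂; swap)
open import Data.Unit using (⊤; tt)
open import Data.Empty using (⊥; ⊥-elim)
open import Function using (_∘_; id)
open import Relation.Binary.PropositionalEquality using (_≡_; _≢_; refl; sym; trans; cong; subst; subst₂)
open import Relation.Nullary using (¬_; Dec; yes; no)
open import Relation.Nullary.Decidable using (_⊎-dec_; _×-dec_; ¬?; map′; dec-true; decidable-stable)
open import Relation.Binary using (tri<; tri≈; tri>)
open import Relation.Unary using (Decidable)

-- Cardinalities of finite sets

compr : ∀ {n} {P : Fin n → Set} → Decidable P → Subset n
compr P? = tabulate (λ x → Dec.does (P? x))

∈-compr⁺ : ∀ {n} {P : Fin n → Set} (P? : Decidable P) {x} → P x → x ∈ compr P?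
∈-compr⁺ P? {x} px = lookup⇒[]= x _ (trans (lookup∘tabulate _ x) (dec-true (P? x) px))

∈-compr⁻ : ∀ {n} {P : Fin n → Set} (P? : Decidable P) {x} → x ∈ compr P? → P x
∈-compr⁻ P? {x} x∈ with P? x | trans (sym (lookup∘tabulate (λ y → Dec.does (P? y)) x)) ([]=⇒lookup x∈)
... | yes px | _  = px
... | no  _  | ()

∣p∪q∣≤∣p∣+∣q∣ : ∀ {n} (p q : Subset n) → ∣ p ∪ q ∣ ≤ ∣ p ∣ + ∣ q ∣
∣p∪q∣≤∣p∣+∣q∣ [] [] = z≤n
∣p∪q∣≤∣p∣+∣q∣ (outside ∷ p) (outside ∷ q) = ∣p∪q∣≤∣p∣+∣q∣ p q
∣p∪q∣≤∣p∣+∣q∣ (outside ∷ p) (inside ∷ q) =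
  ≤-trans (s≤s (∣p∪q∣≤∣p∣+∣q∣ p q)) (≤-reflexive (sym (+-suc ∣ p ∣ ∣ q ∣)))
∣p∪q∣≤∣p∣+∣q∣ (inside ∷ p) (outside ∷ q) = s≤s (∣p∪q∣≤∣p∣+∣q∣ p q)
∣p∪q∣≤∣p∣+∣q∣ (inside ∷ p) (inside ∷ q) =
  s≤s (≤-trans (∣p∪q∣≤∣p∣+∣q∣ p q) (+-monoʳ-≤ ∣ p ∣ (n≤1+n ∣ q ∣)))

∣p∪⁅x⁆∣≤1+∣p∣ : ∀ {n} (p : Subset n) x → ∣ p ∪ ⁅ x ⁆ ∣ ≤ suc ∣ p ∣
∣p∪⁅x⁆∣≤1+∣p∣ p x = ≤-trans (∣p∪q∣≤∣p∣+∣q∣ p ⁅ x ⁆)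
  (≤-reflexive (trans (cong (∣ p ∣ +_) (∣⁅x⁆∣≡1 x)) (+-comm ∣ p ∣ 1)))

cover-bound : ∀ {m n} {A : Set} (S : Subset n) (xs : List A) (F : A → Subset n) →
  (∀ x → x ∈ₗ xs → ∣ F x ∣ ≤ m) → (∀ {y} → y ∈ S → ∃ λ x → x ∈ₗ xs × y ∈ F x) → ∣ S ∣ ≤ length xs * m
cover-bound {m} {n} S xs F F≤m covered =
  ≤-trans (p⊆q⇒∣p∣≤∣q∣ (λ y∈S → let x , x∈xs , y∈F = covered y∈S in F⊆union xs x∈xs y∈F)) (union-bound xs F≤m)
  where
  union : List _ → Subset n
  union []       = Subset.⊥
  union (x ∷ xs) = F x ∪ union xs
  F⊆union : ∀ xs {x} → x ∈ₗ xs → F x ⊆ union xs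
  F⊆union (x ∷ xs) (here refl) y∈ = x∈p∪q⁺ (inj₁ y∈)
  F⊆union (x ∷ xs) (there x∈) y∈ = x∈p∪q⁺ (inj₂ (F⊆union xs x∈ y∈))
  union-bound : ∀ xs → (∀ x → x ∈ₗ xs → ∣ F x ∣ ≤ m) → ∣ union xs ∣ ≤ length xs * m
  union-bound [] _ = ≤-reflexive (∣⊥∣≡0 n)
  union-bound (x ∷ xs) F≤m = ≤-trans (∣p∪q∣≤∣p∣+∣q∣ (F x) (union xs))
    (+-mono-≤ (F≤m x (here refl)) (union-bound xs (λ y y∈ → F≤m y (there y∈))))

elements : ∀ {n} → Subset n → List (Fin n)
elements []            = []
elements (inside ∷ p)  = zero ∷ map suc (elements p)
elements (outside ∷ p) = map suc (elements p)

length-elements : ∀ {n} (p : Subset n) → length (elements p) ≡ ∣ p ∣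
length-elements []            = refl
length-elements (inside ∷ p)  = cong suc (trans (length-map suc (elements p)) (length-elements p))
length-elements (outside ∷ p) = trans (length-map suc (elements p)) (length-elements p)

∈-elements : ∀ {n} {p : Subset n} {x} → x ∈ p → x ∈ₗ elements p
∈-elements {p = inside ∷ p}  here       = here refl
∈-elements {p = inside ∷ p}  (there x∈) = there (∈-map⁺ suc (∈-elements x∈))
∈-elements {p = outside ∷ p} (there x∈) = ∈-map⁺ suc (∈-elements x∈)

elements-∈ : ∀ {n} {p : Subset n} {x} → x ∈ₗ elements p → x ∈ p
elements-∈ {p = inside ∷ p} (here refl) = here
elements-∈ {p = inside ∷ p} (there x∈) with ∈-map⁻ suc x∈
... | y , y∈ , refl = there (elements-∈ y∈)
elements-∈ {p = outside ∷ p} x∈ with ∈-map⁻ suc x∈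
... | y , y∈ , refl = there (elements-∈ y∈)

injection⇒≤∣p∣ : ∀ {n} k (p : Subset n) (s : Fin k → Fin n) →
  (∀ i j → s i ≡ s j → i ≡ j) → (∀ i → s i ∈ p) → k ≤ ∣ p ∣
injection⇒≤∣p∣ zero p s inj s∈ = z≤n
injection⇒≤∣p∣ (suc k) p s inj s∈ = ≤-<-trans
  (injection⇒≤∣p∣ k (p - s zero) (s ∘ suc) (λ i j eq → Finₚ.suc-injective (inj _ _ eq))
    (λ i → x∈p∧x≢y⇒x∈p-y (s∈ (suc i)) (λ eq → Finₚ.0≢1+n (sym (inj _ _ eq)))))
  (x∈p⇒∣p-x∣<∣p∣ (s∈ zero))

injection-surjective : ∀ {n} k (p : Subset n) (s : Fin k → Fin n) →
  (∀ i j → s i ≡ s j → i ≡ j) → (∀ i → s i ∈ p) → ∣ p ∣ ≤ k → ∀ y → y ∈ p → ∃ λ i → s i ≡ y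
injection-surjective k p s inj s∈ ∣p∣≤k y y∈p with Finₚ.any? (λ i → s i Fin.≟ y)
... | yes hit = hit
... | no miss = ⊥-elim (<-irrefl refl (≤-<-trans
  (injection⇒≤∣p∣ k (p - y) s inj (λ i → x∈p∧x≢y⇒x∈p-y (s∈ i) (λ eq → miss (i , eq))))
  (<-≤-trans (x∈p⇒∣p-x∣<∣p∣ y∈p) ∣p∣≤k)))

-- Walks and reachability

Conn : (G : Multigraph) → (Fin (nV G) → Set) → (Fin (nE G) → Set) → Fin (nV G) → Fin (nV G) → Set
Conn G P Q u v = ∃₂ λ vs es → Walk G P Q u v vs es

module _ {G : Multigraph} where

  Joins-sym : ∀ {e u v} → Joins G e u v → Joins G e v u
  Joins-sym (inj₁ p) = inj₂ p
  Joins-sym (inj₂ p) = inj₁ p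

  Joins-ends : ∀ {e u v x y} → Joins G e u v → Joins G e x y → x ≡ u ⊎ x ≡ v
  Joins-ends (inj₁ (refl , refl)) (inj₁ (refl , refl)) = inj₁ refl
  Joins-ends (inj₁ (refl , refl)) (inj₂ (refl , refl)) = inj₂ refl
  Joins-ends (inj₂ (refl , refl)) (inj₁ (refl , refl)) = inj₂ refl
  Joins-ends (inj₂ (refl , refl)) (inj₂ (refl , refl)) = inj₁ refl

  Joins? : ∀ e u v → Dec (Joins G e u v)
  Joins? e u v = ((src G e Fin.≟ u) ×-dec (tgt G e Fin.≟ v)) ⊎-dec ((src G e Fin.≟ v) ×-dec (tgt G e Fin.≟ u))

  module _ {P : Fin (nV G) → Set} {Q : Fin (nE G) → Set} where

    infix 4 _∼_
    _∼_ : Fin (nV G) → Fin (nV G) → Set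
    _∼_ = Conn G P Q

    ∼-refl : ∀ {u} → P u → u ∼ u
    ∼-refl Pu = _ , _ , stop Pu

    ∼-step : ∀ {u v w} e → P u → Q e → Joins G e u v → v ∼ w → u ∼ w
    ∼-step e Pu Qe j (_ , _ , p) = _ , _ , step e Pu Qe j p

    ∼-trans : ∀ {u v w} → u ∼ v → v ∼ w → u ∼ w
    ∼-trans (_ , _ , stop _)           q = q
    ∼-trans (_ , _ , step e Pu Qe j p) q = ∼-step e Pu Qe j (∼-trans (_ , _ , p) q)

    ∼-source : ∀ {u v} → u ∼ v → P u
    ∼-source (_ , _ , stop Pu)         = Pu
    ∼-source (_ , _ , step _ Pu _ _ _) = Pu

    ∼-snoc : ∀ {u v w} e → u ∼ v → Q e → Joins G e v w → P w → u ∼ w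
    ∼-snoc e (_ , _ , stop Pu) Qe j Pw = ∼-step e Pu Qe j (∼-refl Pw)
    ∼-snoc e (_ , _ , step e′ Pu Qe′ j′ p) Qe j Pw = ∼-step e′ Pu Qe′ j′ (∼-snoc e (_ , _ , p) Qe j Pw)

    ∼-sym : ∀ {u v} → u ∼ v → v ∼ u
    ∼-sym (_ , _ , stop Pu)           = ∼-refl Pu
    ∼-sym (_ , _ , step e Pu Qe j p) = ∼-snoc e (∼-sym (_ , _ , p)) Qe (Joins-sym j) Pu

    ∼-target : ∀ {u v} → u ∼ v → P v
    ∼-target = ∼-source ∘ ∼-sym

    ∼-closed : ∀ {S : Fin (nV G) → Set} →
      (∀ {x y} e → S x → P x → P y → Q e → Joins G e x y → S y) → ∀ {u v} → S u → u ∼ v → S v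
    ∼-closed cl Su (_ , _ , stop _)           = Su
    ∼-closed cl Su (_ , _ , step e Pu Qe j p) =
      ∼-closed cl (cl e Su Pu (∼-source (_ , _ , p)) Qe j) (_ , _ , p)

    module _ (P? : Decidable P) (Q? : Decidable Q) (u : Fin (nV G)) where

      Closed : Subset (nV G) → Set
      Closed S = ∀ {x y} e → x ∈ S → P y → Q e → Joins G e x y → y ∈ S

      -- Vertices reachable in one more step are added until none is left. Each addition enlarges S,
      -- so the bound on `fuel + ∣ S ∣` persists, and the fuel cannot run out while a vertex is
      -- missing.
      saturate : ∀ fuel S → nV G ≤ fuel + ∣ S ∣ → (∀ {y} → y ∈ S → u ∼ y) → u ∈ S →
        ∃ λ S′ → (∀ {y} → y ∈ S′ → u ∼ y) × u ∈ S′ × Closed S′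
      saturate fuel S bound S∼ u∈
        with Finₚ.any? (λ y → ¬? (y ∈? S) ×-dec P? y ×-dec
               Finₚ.any? (λ x → (x ∈? S) ×-dec Finₚ.any? (λ e → Q? e ×-dec Joins? e x y)))
      ... | no none = S , S∼ , u∈ , closed′
        where
        closed′ : Closed S
        closed′ {x} {y} e x∈ Py Qe j = decidable-stable (y ∈? S) (λ y∉ → none (y , y∉ , Py , x , x∈ , e , Qe , j))
      ... | yes (y , y∉ , Py , x , x∈ , e , Qe , j) = grow fuel bound
        where
        S<S∪y : ∣ S ∣ < ∣ S ∪ ⁅ y ⁆ ∣
        S<S∪y = p⊂q⇒∣p∣<∣q∣ ((x∈p∪q⁺ ∘ inj₁) , y , x∈p∪q⁺ (inj₂ (x∈⁅x⁆ y)) , y∉)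
        S∪y∼ : ∀ {z} → z ∈ S ∪ ⁅ y ⁆ → u ∼ z
        S∪y∼ z∈ with x∈p∪q⁻ S ⁅ y ⁆ z∈
        ... | inj₁ z∈S = S∼ z∈S
        ... | inj₂ z∈y = subst (u ∼_) (sym (x∈⁅y⁆⇒x≡y y z∈y)) (∼-snoc e (S∼ x∈) Qe j Py)
        grow : ∀ fuel → nV G ≤ fuel + ∣ S ∣ → ∃ λ S′ → (∀ {z} → z ∈ S′ → u ∼ z) × u ∈ S′ × Closed S′
        grow zero    bound = ⊥-elim (<-irrefl refl (<-≤-trans S<S∪y (≤-trans (∣p∣≤n (S ∪ ⁅ y ⁆)) bound)))
        grow (suc f) bound = saturate f (S ∪ ⁅ y ⁆)
          (≤-trans bound (≤-trans (≤-reflexive (sym (+-suc f ∣ S ∣))) (+-monoʳ-≤ f S<S∪y)))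
          S∪y∼ (x∈p∪q⁺ (inj₁ u∈))

    _∼?[_,_]_ : ∀ u → Decidable P → Decidable Q → ∀ v → Dec (u ∼ v)
    u ∼?[ P? , Q? ] v with P? u
    ... | no ¬Pu = no (¬Pu ∘ ∼-source)
    ... | yes Pu with saturate P? Q? u (nV G) ⁅ u ⁆ (m≤m+n _ _)
                        (λ y∈ → subst (u ∼_) (sym (x∈⁅y⁆⇒x≡y u y∈)) (∼-refl Pu)) (x∈⁅x⁆ u)
    ...   | S , S∼ , u∈ , cl = map′ S∼ (∼-closed {S = _∈ S} (λ e x∈ _ → cl e x∈) u∈) (v ∈? S)

  ∼-map : ∀ {P P′ : Fin (nV G) → Set} {Q Q′ : Fin (nE G) → Set} →
    (∀ {x} → P x → P′ x) → (∀ {x y} e → P x → P y → Joins G e x y → Q e → Q′ e) →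
    ∀ {u v} → Conn G P Q u v → Conn G P′ Q′ u v
  ∼-map f g (_ , _ , stop Pu)           = ∼-refl (f Pu)
  ∼-map f g (_ , _ , step e Pu Qe j p) =
    ∼-step e (f Pu) (g e Pu (∼-source (_ , _ , p)) j Qe) j (∼-map f g (_ , _ , p))

  module _ {P : Fin (nV G) → Set} {Q : Fin (nE G) → Set} where

    -- Stopping at the first vertex in X keeps the initial segment outside X, which identifies the
    -- component of the source once X is removed.
    walk-first-entry : ∀ (X : Subset (nV G)) {u v vs es} → Walk G P Q u v vs es → u ∉ X → v ∈ X →
      ∃₂ λ x y → ∃ λ e → Conn G (λ z → P z × z ∉ X) Q u x × Q e × Joins G e x y × y ∈ X
    walk-first-entry X (stop _) u∉ v∈ = ⊥-elim (u∉ v∈)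
    walk-first-entry X (step {v = v} e Pu Qe j p) u∉ w∈ with v ∈? X
    ... | yes v∈ = _ , v , e , ∼-refl (Pu , u∉) , Qe , j , v∈
    ... | no  v∉ with walk-first-entry X p v∉ w∈
    ...   | x , y , e′ , q , r = x , y , e′ , ∼-step e (Pu , u∉) Qe j q , r

    ∼-crossing : ∀ (X : Subset (nV G)) {u v} → Conn G P Q u v → u ∉ X → v ∈ X →
      ∃₂ λ x y → Conn G P Q u x × (∃ λ e → Joins G e x y) × x ∉ X × y ∈ X
    ∼-crossing X (_ , _ , p) u∉ v∈ with walk-first-entry X p u∉ v∈
    ... | x , y , e , q , _ , j , y∈ =
      x , y , ∼-map proj₁ (λ _ _ _ _ → id) q , (e , j) , proj₂ (∼-target q) , y∈

    -- All vertices of the second walk are themselves reachable from z; this makes a component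
    -- connected within itself.
    ∼-reached : ∀ {z u v} → Conn G P Q z u → Conn G P Q u v → Conn G (Conn G P Q z) Q u v
    ∼-reached z∼u (_ , _ , stop _)           = ∼-refl z∼u
    ∼-reached z∼u (_ , _ , step e Pu Qe j p) =
      ∼-step e z∼u Qe j (∼-reached (∼-snoc e z∼u Qe j (∼-source (_ , _ , p))) (_ , _ , p))

  module _ {P : Fin (nV G) → Set} {Q : Fin (nE G) → Set} where

    Path : Fin (nV G) → Fin (nV G) → List (Fin (nV G)) → Set
    Path u v vs = (∃ λ es → Walk G P Q u v vs es) × Unique vs

    path-suffix : ∀ {u v x vs} → Path u v vs → x ∈ₗ vs →
      ∃ λ vs′ → Path x v vs′ × (∀ {y} → y ∈ₗ vs′ → y ∈ₗ vs)
    path-suffix p@((_ , stop _) , _)         (here refl) = _ , p , id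
    path-suffix p@((_ , step _ _ _ _ _) , _) (here refl) = _ , p , id
    path-suffix ((_ , step e Pu Qe j w) , _ ∷ uniq) (there x∈) =
      let vs′ , q , sub = path-suffix ((_ , w) , uniq) x∈ in vs′ , q , there ∘ sub

    -- The inclusion of vertex lists is recorded so that disjoint walks stay disjoint when shortened
    -- to paths.
    erase-loops : ∀ {u v vs es} → Walk G P Q u v vs es →
      ∃ λ vs′ → Path u v vs′ × (∀ {y} → y ∈ₗ vs′ → y ∈ₗ vs)
    erase-loops (stop Pu) = _ , ((_ , stop Pu) , [] ∷ []) , id
    erase-loops {u} (step e Pu Qe j w) with erase-loops w
    ... | vs′ , q@((_ , w′) , uniq) , sub with DecMembership._∈?_ Fin._≟_ u vs′
    ...   | yes u∈ = let vs″ , r , sub′ = path-suffix q u∈ in vs″ , r , there ∘ sub ∘ sub′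
    ...   | no  u∉ = u ∷ vs′ , ((_ , step e Pu Qe j w′) , Allₚ.¬Any⇒All¬ _ u∉ ∷ uniq) ,
                     λ { (here eq) → here eq ; (there y∈) → there (sub y∈) }

    edge-end-∈ : ∀ {u v vs es e x y} → Walk G P Q u v vs es → e ∈ₗ es → Joins G e x y → x ∈ₗ vs
    edge-end-∈ (step e Pu Qe j w) (here refl) i with Joins-ends j i
    ... | inj₁ refl = here refl
    ... | inj₂ refl = there (source-∈ w)
      where
      source-∈ : ∀ {u v vs es} → Walk G P Q u v vs es → u ∈ₗ vs
      source-∈ (stop _)         = here refl
      source-∈ (step _ _ _ _ _) = here refl
    edge-end-∈ (step e Pu Qe j w) (there e∈) i = there (edge-end-∈ w e∈ i)

    path-edges-unique : ∀ {u v vs es} → Walk G P Q u v vs es → Unique vs → Unique es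
    path-edges-unique (stop _) _ = []
    path-edges-unique (step e Pu Qe j w) (u∉ ∷ uniq) =
      Allₚ.¬Any⇒All¬ _ (λ e∈ → Allₚ.All¬⇒¬Any u∉ (edge-end-∈ w e∈ j)) ∷ path-edges-unique w uniq

    walk-edges : ∀ {u v vs es} → Walk G P Q u v vs es → All Q es
    walk-edges (stop _)           = []
    walk-edges (step e Pu Qe j w) = Qe ∷ walk-edges w

  walk-map : ∀ {P P′ : Fin (nV G) → Set} {Q Q′ : Fin (nE G) → Set} → (∀ {x} → P x → P′ x) → (∀ {e} → Q e → Q′ e) →
    ∀ {u v vs es} → Walk G P Q u v vs es → Walk G P′ Q′ u v vs es
  walk-map f g (stop Pu)           = stop (f Pu)
  walk-map f g (step e Pu Qe j w) = step e (f Pu) (g Qe) j (walk-map f g w)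

  -- Loop erasure turns the detour into a path still avoiding e, which e closes to a cycle.
  bypass⇒cycle : ∀ {e x y} → Joins G e x y → Conn G (λ _ → ⊤) (λ e′ → e ≢ e′) x y → HasCycle G
  bypass⇒cycle j (_ , _ , w) with erase-loops w
  ... | vs , ((es , p) , uniq) , _ = _ , _ , vs , es , _ ,
    walk-map id (λ _ → tt) p , uniq , walk-edges p ∷ path-edges-unique p uniq , Joins-sym j

-- Menger's theorem for directed graphs, after Göring

enumerate : ∀ {n} (p : Subset n) → Fin ∣ p ∣ → Fin n
enumerate (inside ∷ p)  zero    = zero
enumerate (inside ∷ p)  (suc i) = suc (enumerate p i)
enumerate (outside ∷ p) i       = suc (enumerate p i)

enumerate-∈ : ∀ {n} (p : Subset n) i → enumerate p i ∈ p
enumerate-∈ (inside ∷ p)  zero    = here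
enumerate-∈ (inside ∷ p)  (suc i) = there (enumerate-∈ p i)
enumerate-∈ (outside ∷ p) i       = there (enumerate-∈ p i)

enumerate-injective : ∀ {n} (p : Subset n) i j → enumerate p i ≡ enumerate p j → i ≡ j
enumerate-injective (inside ∷ p)  zero    zero    _  = refl
enumerate-injective (inside ∷ p)  (suc i) (suc j) eq = cong suc (enumerate-injective p i j (Finₚ.suc-injective eq))
enumerate-injective (outside ∷ p) i       j       eq = enumerate-injective p i j (Finₚ.suc-injective eq)

Arcs : ℕ → Set
Arcs n = List (Fin n × Fin n)

-- Routes may repeat vertices: only different routes have to be disjoint, and loops are erased at
-- the end.
data Route {n} (E : Arcs n) : Fin n → Fin n → List (Fin n) → Set where
  here : ∀ u → Route E u u (u ∷ [])
  via  : ∀ {u v w vs} → (u , v) ∈ₗ E → Route E v w vs → Route E u w (u ∷ vs)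

module _ {n} {E : Arcs n} where

  route-source : ∀ {u v vs} → Route E u v vs → u ∈ₗ vs
  route-source (here u)  = here refl
  route-source (via _ _) = here refl

  route-target : ∀ {u v vs} → Route E u v vs → v ∈ₗ vs
  route-target (here u)  = here refl
  route-target (via _ r) = there (route-target r)

  route-append : ∀ {u v w ps qs} → Route E u v ps → Route E v w qs →
    ∃ λ rs → Route E u w rs × (∀ {x} → x ∈ₗ rs → x ∈ₗ ps ⊎ x ∈ₗ qs)
  route-append (here u)  q = _ , q , inj₂
  route-append (via a p) q with route-append p q
  ... | rs , r , sub = _ , via a r ,
    λ { (here eq) → inj₁ (here eq) ; (there x∈) → map₁ there (sub x∈) }

  route-mono : ∀ {E′ : Arcs n} → (∀ {a} → a ∈ₗ E → a ∈ₗ E′) → ∀ {u v vs} → Route E u v vs → Route E′ u v vs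
  route-mono f (here u)  = here u
  route-mono f (via a r) = via (f a) (route-mono f r)

record Linkage {n} (E : Arcs n) (A B : Subset n) (k : ℕ) : Set where
  field
    start end : Fin k → Fin n
    verts     : Fin k → List (Fin n)
    route     : ∀ i → Route E (start i) (end i) (verts i)
    start-∈   : ∀ i → start i ∈ A
    end-∈     : ∀ i → end i ∈ B
    disjoint  : ∀ i j {x} → x ∈ₗ verts i → x ∈ₗ verts j → i ≡ j

  start-injective : ∀ i j → start i ≡ start j → i ≡ j
  start-injective i j eq =
    disjoint i j (route-source (route i)) (subst (_∈ₗ verts j) (sym eq) (route-source (route j)))

  end-injective : ∀ i j → end i ≡ end j → i ≡ j
  end-injective i j eq =
    disjoint i j (route-target (route i)) (subst (_∈ₗ verts j) (sym eq) (route-target (route j)))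

-- A separator, given by the side U containing A together with a set
-- containing the vertices of U that lie in B or send an arc out of U.
record Separator {n} (E : Arcs n) (A B : Subset n) (k : ℕ) : Set where
  field
    side bdry : Subset n
    A⊆side    : A ⊆ side
    B-bdry    : ∀ {x} → x ∈ side → x ∈ B → x ∈ bdry
    arc-bdry  : ∀ {x y} → (x , y) ∈ₗ E → x ∈ side → y ∉ side → x ∈ bdry
    small     : ∣ bdry ∣ < k

-- Without arcs the only routes are single vertices of `A ∩ B`: k of them form a linkage, and
-- otherwise A itself is the side of a separator.
menger-no-arcs : ∀ {n} (A B : Subset n) k → Linkage [] A B k ⊎ Separator [] A B k
menger-no-arcs A B k with k ≤? ∣ A ∩ B ∣
... | no k≰ = inj₂ record
  { side = A ; bdry = A ∩ B ; A⊆side = id ; B-bdry = λ x∈A x∈B → x∈p∩q⁺ (x∈A , x∈B)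
  ; arc-bdry = λ () ; small = ≰⇒> k≰ }
... | yes k≤ = inj₁ record
  { start = pick ; end = pick ; verts = λ i → pick i ∷ []
  ; route = λ i → here (pick i)
  ; start-∈ = λ i → proj₁ (pick-∈ i)
  ; end-∈ = λ i → proj₂ (pick-∈ i)
  ; disjoint = λ { i j (here refl) (here eq) →
      Finₚ.inject≤-injective k≤ k≤ i j (enumerate-injective (A ∩ B) _ _ eq) } }
  where
  pick : Fin k → _
  pick i = enumerate (A ∩ B) (Fin.inject≤ i k≤)
  pick-∈ : ∀ i → pick i ∈ A × pick i ∈ B
  pick-∈ i = x∈p∩q⁻ A B (enumerate-∈ (A ∩ B) (Fin.inject≤ i k≤))

-- The new arc from x₀ to y₀ leaves the side U of a small separator for the old arcs. A separator
-- between A and `S∪x₀`, or between `S∪y₀` and B, also separates A from B; two linkages of size k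
-- instead can be glued along S and the new arc.
module Göring {n} (x₀ y₀ : Fin n) (E : Arcs n) (A B : Subset n) (k : ℕ)
  (sep : Separator E A B k)
  (x₀∈ : x₀ ∈ Separator.side sep) (y₀∉ : y₀ ∉ Separator.side sep) where

  open Separator sep renaming (side to U; bdry to S)

  -- Routes along `E₁` from A stay in U and meet S only at the end, as no arc starts in S. Routes
  -- along `E₂` meet U only at the start, as no arc ends in U. So left and right routes can only
  -- meet where they are to be glued.
  Left? : Decidable (λ (a : Fin n × Fin n) → (proj₁ a ∉ S) × proj₂ a ∈ U)
  Left? (x , y) = ¬? (x ∈? S) ×-dec (y ∈? U)

  Right? : Decidable (λ (a : Fin n × Fin n) → proj₂ a ∉ U)
  Right? (x , y) = ¬? (y ∈? U)

  E₁ E₂ : Arcs n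
  E₁ = filter Left? E
  E₂ = filter Right? E

  S∪x₀ S∪y₀ : Subset n
  S∪x₀ = S ∪ ⁅ x₀ ⁆
  S∪y₀ = S ∪ ⁅ y₀ ⁆

  -- An arc leaving `U₁ ∩ U` starts in S or at x₀, both targets of the left problem, or is an arc of
  -- `E₁` leaving `U₁`.
  separator₁ : Separator E₁ A S∪x₀ k → Separator ((x₀ , y₀) ∷ E) A B k
  separator₁ sep₁ = record
    { side = U₁ ∩ U ; bdry = Separator.bdry sep₁
    ; A⊆side = λ x∈ → x∈p∩q⁺ (Separator.A⊆side sep₁ x∈ , A⊆side x∈)
    ; B-bdry = λ x∈ x∈B → let x∈U₁ , x∈U = x∈p∩q⁻ U₁ U x∈ in
        target x∈U₁ (x∈p∪q⁺ (inj₁ (B-bdry x∈U x∈B)))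
    ; arc-bdry = arcs ; small = Separator.small sep₁ }
    where
    U₁ = Separator.side sep₁
    target : ∀ {x} → x ∈ U₁ → x ∈ S∪x₀ → x ∈ Separator.bdry sep₁
    target = Separator.B-bdry sep₁
    arcs : ∀ {x y} → (x , y) ∈ₗ (x₀ , y₀) ∷ E → x ∈ U₁ ∩ U → y ∉ U₁ ∩ U → x ∈ Separator.bdry sep₁
    arcs (here refl) x∈ y∉ = target (proj₁ (x∈p∩q⁻ U₁ U x∈)) (x∈p∪q⁺ (inj₂ (x∈⁅x⁆ x₀)))
    arcs {x} {y} (there a) x∈ y∉ with x∈p∩q⁻ U₁ U x∈ | y ∈? U | x ∈? S
    ... | x∈U₁ , x∈U | no y∉U  | _       = target x∈U₁ (x∈p∪q⁺ (inj₁ (arc-bdry a x∈U y∉U)))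
    ... | x∈U₁ , x∈U | yes y∈U | yes x∈S = target x∈U₁ (x∈p∪q⁺ (inj₁ x∈S))
    ... | x∈U₁ , x∈U | yes y∈U | no x∉S  =
      Separator.arc-bdry sep₁ (∈-filter⁺ Left? a (x∉S , y∈U)) x∈U₁ (λ y∈U₁ → y∉ (x∈p∩q⁺ (y∈U₁ , y∈U)))

  -- An old arc leaving `U₂ ∪ U` ends outside U and so belongs to `E₂`; if it starts in U, it starts
  -- in S, which lies in `U₂`. The new arc ends at y₀, which is in `U₂`.
  separator₂ : Separator E₂ S∪y₀ B k → Separator ((x₀ , y₀) ∷ E) A B k
  separator₂ sep₂ = record
    { side = U₂ ∪ U ; bdry = Separator.bdry sep₂
    ; A⊆side = λ x∈ → x∈p∪q⁺ (inj₂ (A⊆side x∈))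
    ; B-bdry = B-bdry₂ ; arc-bdry = arcs ; small = Separator.small sep₂ }
    where
    U₂ = Separator.side sep₂
    S⊆U₂ : S ⊆ U₂
    S⊆U₂ x∈ = Separator.A⊆side sep₂ (x∈p∪q⁺ (inj₁ x∈))
    B-bdry₂ : ∀ {x} → x ∈ U₂ ∪ U → x ∈ B → x ∈ Separator.bdry sep₂
    B-bdry₂ x∈ x∈B with x∈p∪q⁻ U₂ U x∈
    ... | inj₁ x∈U₂ = Separator.B-bdry sep₂ x∈U₂ x∈B
    ... | inj₂ x∈U  = Separator.B-bdry sep₂ (S⊆U₂ (B-bdry x∈U x∈B)) x∈B
    arcs : ∀ {x y} → (x , y) ∈ₗ (x₀ , y₀) ∷ E → x ∈ U₂ ∪ U → y ∉ U₂ ∪ U → x ∈ Separator.bdry sep₂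
    arcs (here refl) x∈ y∉ = ⊥-elim (y∉ (x∈p∪q⁺ (inj₁ (Separator.A⊆side sep₂ (x∈p∪q⁺ (inj₂ (x∈⁅x⁆ y₀)))))))
    arcs (there a) x∈ y∉ with x∈p∪q⁻ U₂ U x∈
    ... | inj₁ x∈U₂ = Separator.arc-bdry sep₂ (∈-filter⁺ Right? a (y∉ ∘ x∈p∪q⁺ ∘ inj₂)) x∈U₂ (y∉ ∘ x∈p∪q⁺ ∘ inj₁)
    ... | inj₂ x∈U  = Separator.arc-bdry sep₂ (∈-filter⁺ Right? a (y∉ ∘ x∈p∪q⁺ ∘ inj₂))
                        (S⊆U₂ (arc-bdry a x∈U (y∉ ∘ x∈p∪q⁺ ∘ inj₂))) (y∉ ∘ x∈p∪q⁺ ∘ inj₁)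

  left-inside : ∀ {u v vs x} → Route E₁ u v vs → u ∈ U → x ∈ₗ vs → x ∈ U
  left-inside (here u)  u∈ (here refl) = u∈
  left-inside (via a r) u∈ (here refl) = u∈
  left-inside (via a r) u∈ (there x∈)  =
    left-inside r (proj₂ (proj₂ (∈-filter⁻ Left? {xs = E} a))) x∈

  left-meets-S-at-end : ∀ {u v vs x} → Route E₁ u v vs → x ∈ₗ vs → x ∈ S → x ≡ v
  left-meets-S-at-end (here u)  (here refl) _   = refl
  left-meets-S-at-end (via a r) (here refl) x∈S = ⊥-elim (proj₁ (proj₂ (∈-filter⁻ Left? {xs = E} a)) x∈S)
  left-meets-S-at-end (via a r) (there x∈)  x∈S = left-meets-S-at-end r x∈ x∈S

  right-meets-U-at-start : ∀ {u v vs x} → Route E₂ u v vs → x ∈ₗ vs → x ∈ U → x ≡ u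
  right-meets-U-at-start (here u)  (here refl) _   = refl
  right-meets-U-at-start (via a r) (here refl) _   = refl
  right-meets-U-at-start (via a r) (there x∈)  x∈U
    with right-meets-U-at-start r x∈ x∈U
  ... | refl = ⊥-elim (proj₂ (∈-filter⁻ Right? {xs = E} a) x∈U)

  module _ (L : Linkage E₁ A S∪x₀ k) (R : Linkage E₂ S∪y₀ B k) where
    private
      module L = Linkage L
      module R = Linkage R

    -- A left route continues either through the new arc or at a vertex of S where a right route
    -- starts.
    record Join (i : Fin k) : Set where
      field
        partner  : Fin k
        verts    : List (Fin n)
        route    : Route ((x₀ , y₀) ∷ E) (L.start i) (R.end partner) verts
        split    : ∀ {x} → x ∈ₗ verts → x ∈ₗ L.verts i ⊎ x ∈ₗ R.verts partner
        partner≡ : (L.end i ≡ x₀ × R.start partner ≡ y₀) ⊎ (L.end i ≡ R.start partner)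

    left-route : ∀ i → Route ((x₀ , y₀) ∷ E) (L.start i) (L.end i) (L.verts i)
    left-route i = route-mono (λ a∈ → there (proj₁ (∈-filter⁻ Left? {xs = E} a∈))) (L.route i)

    right-route : ∀ j → Route ((x₀ , y₀) ∷ E) (R.start j) (R.end j) (R.verts j)
    right-route j = route-mono (λ a∈ → there (proj₁ (∈-filter⁻ Right? {xs = E} a∈))) (R.route j)

    -- Since S has fewer than k elements, `S∪y₀` has at most k, and k distinct starts exhaust it.
    starts-surjective : ∀ y → y ∈ S∪y₀ → ∃ λ j → R.start j ≡ y
    starts-surjective = injection-surjective k S∪y₀ R.start R.start-injective R.start-∈
      (≤-trans (∣p∪⁅x⁆∣≤1+∣p∣ S y₀) small)

    join : ∀ i → Join i
    join i with L.end i Fin.≟ x₀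
    ... | yes end≡x₀ = record
      { partner = j ; verts = rs ; route = r
      ; split = λ x∈ → [ inj₁ , (λ { (here refl) → inj₁ (subst (_∈ₗ _) end≡x₀ (route-target (L.route i))) ; (there x∈) → inj₂ x∈ }) ]′ (sub x∈)
      ; partner≡ = inj₁ (end≡x₀ , start≡y₀) }
      where
      found = starts-surjective y₀ (x∈p∪q⁺ (inj₂ (x∈⁅x⁆ y₀)))
      j = proj₁ found
      start≡y₀ = proj₂ found
      joined = route-append (subst (λ v → Route _ _ v _) end≡x₀ (left-route i))
                 (via (here refl) (subst (λ v → Route ((x₀ , y₀) ∷ E) v (R.end j) (R.verts j)) start≡y₀ (right-route j)))
      rs = proj₁ joined
      r = proj₁ (proj₂ joined)
      sub = proj₂ (proj₂ joined)
    ... | no end≢x₀ = record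
      { partner = j ; verts = proj₁ joined ; route = proj₁ (proj₂ joined)
      ; split = proj₂ (proj₂ joined) ; partner≡ = inj₂ (sym start≡end) }
      where
      end∈S : L.end i ∈ S
      end∈S with x∈p∪q⁻ S ⁅ x₀ ⁆ (L.end-∈ i)
      ... | inj₁ ∈S = ∈S
      ... | inj₂ ∈x = ⊥-elim (end≢x₀ (x∈⁅y⁆⇒x≡y x₀ ∈x))
      found = starts-surjective (L.end i) (x∈p∪q⁺ (inj₁ end∈S))
      j = proj₁ found
      start≡end = proj₂ found
      joined = route-append (left-route i) (subst (λ v → Route ((x₀ , y₀) ∷ E) v (R.end j) (R.verts j)) start≡end (right-route j))

    end-∈U : ∀ i → L.end i ∈ U
    end-∈U i = left-inside (L.route i) (A⊆side (L.start-∈ i)) (route-target (L.route i))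

    -- In the mixed cases a left end would equal y₀, which lies outside U.
    partner-injective : ∀ i i′ → Join.partner (join i) ≡ Join.partner (join i′) → i ≡ i′
    partner-injective i i′ eq with join i | join i′
    ... | J | J′ with Join.partner≡ J | Join.partner≡ J′
    ... | inj₁ (e , _) | inj₁ (e′ , _) = L.end-injective i i′ (trans e (sym e′))
    ... | inj₂ e       | inj₂ e′       = L.end-injective i i′ (trans e (trans (cong R.start eq) (sym e′)))
    ... | inj₁ (_ , s) | inj₂ e′       = ⊥-elim (y₀∉ (subst (_∈ U) (trans e′ (trans (cong R.start (sym eq)) s)) (end-∈U i′)))
    ... | inj₂ e       | inj₁ (_ , s)  = ⊥-elim (y₀∉ (subst (_∈ U) (trans e (trans (cong R.start eq) s)) (end-∈U i)))

    -- A common vertex lies in U, hence is the start of the right route and in S, hence is the end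
    -- of the left route; so these two are the routes that were joined.
    left-right : ∀ i i′ {x} → x ∈ₗ L.verts i → x ∈ₗ R.verts (Join.partner (join i′)) → i ≡ i′
    left-right i i′ x∈L x∈R with join i′
    ... | J′ with left-inside (L.route i) (A⊆side (L.start-∈ i)) x∈L
    ... | x∈U with right-meets-U-at-start (R.route (Join.partner J′)) x∈R x∈U
    ... | refl with x∈p∪q⁻ S ⁅ y₀ ⁆ (R.start-∈ (Join.partner J′))
    ... | inj₂ ∈y = ⊥-elim (y₀∉ (subst (_∈ U) (x∈⁅y⁆⇒x≡y y₀ ∈y) x∈U))
    ... | inj₁ ∈S with left-meets-S-at-end (L.route i) x∈L ∈S | Join.partner≡ J′
    ... | _  | inj₁ (_ , s) = ⊥-elim (y₀∉ (subst (_∈ U) s x∈U))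
    ... | eq | inj₂ e       = L.end-injective i i′ (trans (sym eq) (sym e))

    linkage : Linkage ((x₀ , y₀) ∷ E) A B k
    linkage = record
      { start = L.start ; end = λ i → R.end (Join.partner (join i))
      ; verts = λ i → Join.verts (join i) ; route = λ i → Join.route (join i)
      ; start-∈ = L.start-∈ ; end-∈ = λ i → R.end-∈ _ ; disjoint = disj }
      where
      disj : ∀ i i′ {x} → x ∈ₗ Join.verts (join i) → x ∈ₗ Join.verts (join i′) → i ≡ i′
      disj i i′ x∈ x∈′ with Join.split (join i) x∈ | Join.split (join i′) x∈′
      ... | inj₁ p | inj₁ q = L.disjoint i i′ p q
      ... | inj₂ p | inj₂ q = partner-injective i i′ (R.disjoint _ _ p q)
      ... | inj₁ p | inj₂ q = left-right i i′ p q
      ... | inj₂ p | inj₁ q = sym (left-right i′ i q p)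

-- The induction is on a bound for the number of arcs rather than on the list, because the two
-- subproblems use filtered lists.
menger-bounded : ∀ {n} m (E : Arcs n) → length E ≤ m → ∀ A B k → Linkage E A B k ⊎ Separator E A B k
menger-bounded m       []               _        A B k = menger-no-arcs A B k
menger-bounded (suc m) ((x₀ , y₀) ∷ E) (s≤s ≤m) A B k with menger-bounded m E ≤m A B k
... | inj₁ L = inj₁ record
  { start = start ; end = end ; verts = verts ; route = λ i → route-mono there (route i)
  ; start-∈ = start-∈ ; end-∈ = end-∈ ; disjoint = disjoint }
  where open Linkage L
... | inj₂ sep with x₀ ∈? Separator.side sep | y₀ ∈? Separator.side sep
...   | yes x₀∈ | no y₀∉ with menger-bounded m (Göring.E₁ x₀ y₀ E A B k sep x₀∈ y₀∉)
                                (≤-trans (length-filter _ E) ≤m) A (Göring.S∪x₀ x₀ y₀ E A B k sep x₀∈ y₀∉) k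
...     | inj₂ sep₁ = inj₂ (Göring.separator₁ x₀ y₀ E A B k sep x₀∈ y₀∉ sep₁)
...     | inj₁ L with menger-bounded m (Göring.E₂ x₀ y₀ E A B k sep x₀∈ y₀∉)
                                (≤-trans (length-filter _ E) ≤m) (Göring.S∪y₀ x₀ y₀ E A B k sep x₀∈ y₀∉) B k
...       | inj₂ sep₂ = inj₂ (Göring.separator₂ x₀ y₀ E A B k sep x₀∈ y₀∉ sep₂)
...       | inj₁ R    = inj₁ (Göring.linkage x₀ y₀ E A B k sep x₀∈ y₀∉ L R)
menger-bounded (suc m) ((x₀ , y₀) ∷ E) (s≤s ≤m) A B k | inj₂ sep | no x₀∉ | _ = inj₂ record
  { side = side ; bdry = bdry ; A⊆side = A⊆side ; B-bdry = B-bdry ; small = small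
  ; arc-bdry = λ { (here refl) x∈ _ → ⊥-elim (x₀∉ x∈) ; (there a) → arc-bdry a } }
  where open Separator sep
menger-bounded (suc m) ((x₀ , y₀) ∷ E) (s≤s ≤m) A B k | inj₂ sep | yes _ | yes y₀∈ = inj₂ record
  { side = side ; bdry = bdry ; A⊆side = A⊆side ; B-bdry = B-bdry ; small = small
  ; arc-bdry = λ { (here refl) _ y∉ → ⊥-elim (y∉ y₀∈) ; (there a) → arc-bdry a } }
  where open Separator sep

menger : ∀ {n} (E : Arcs n) A B k → Linkage E A B k ⊎ Separator E A B k
menger E = menger-bounded (length E) E ≤-refl

-- Nested families of vertex sets

module _ (G : Multigraph) where

  Adj : Fin (nV G) → Fin (nV G) → Set
  Adj x y = ∃ λ e → Joins G e x y

  Adj-sym : ∀ {x y} → Adj x y → Adj y x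
  Adj-sym (e , j) = e , Joins-sym {G} j

  InBoundary : Subset (nV G) → Subset (nV G) → Fin (nV G) → Set
  InBoundary B X x = x ∈ B × x ∉ X × ∃ λ y → y ∈ X × Adj x y

  InBoundary? : ∀ B X → Decidable (InBoundary B X)
  InBoundary? B X x = (x ∈? B) ×-dec ¬? (x ∈? X) ×-dec
    Finₚ.any? (λ y → (y ∈? X) ×-dec Finₚ.any? (λ e → Joins? {G} e x y))

  ∂ : Subset (nV G) → Subset (nV G) → Subset (nV G)
  ∂ B X = compr (InBoundary? B X)

  ∈∂⁺ : ∀ {B X x y} → x ∈ B → x ∉ X → y ∈ X → Adj x y → x ∈ ∂ B X
  ∈∂⁺ x∈ x∉ y∈ a = ∈-compr⁺ (InBoundary? _ _) (x∈ , x∉ , _ , y∈ , a)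

  ∈∂⁻ : ∀ {B X x} → x ∈ ∂ B X → InBoundary B X x
  ∈∂⁻ = ∈-compr⁻ (InBoundary? _ _)

  -- The layer between X and Y with the boundary of X attached. Edges need an end in X, so those
  -- inside the boundary of X are left to other parts and consecutive layers become edge-disjoint.
  module Region (B X Y : Subset (nV G)) where

    InV : Fin (nV G) → Set
    InV x = (x ∈ X × x ∉ Y) ⊎ x ∈ ∂ B X

    InV? : Decidable InV
    InV? x = ((x ∈? X) ×-dec ¬? (x ∈? Y)) ⊎-dec (x ∈? ∂ B X)

    InE : Fin (nE G) → Set
    InE e = InV (src G e) × InV (tgt G e) × (src G e ∈ X ⊎ tgt G e ∈ X)

    InE? : Decidable InE
    InE? e = InV? (src G e) ×-dec InV? (tgt G e) ×-dec ((src G e ∈? X) ⊎-dec (tgt G e ∈? X))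

    region : Subgraph G
    region = record
      { V = compr InV? ; E = compr InE?
      ; closed = λ e e∈ → let s , t , _ = ∈-compr⁻ InE? e∈ in ∈-compr⁺ InV? s , ∈-compr⁺ InV? t }

    ∈V⁺ : ∀ {x} → InV x → x ∈ V region
    ∈V⁺ = ∈-compr⁺ InV?

    ∈V⁻ : ∀ {x} → x ∈ V region → InV x
    ∈V⁻ = ∈-compr⁻ InV?

    ∈E⁺ : ∀ {e x y} → Joins G e x y → x ∈ V region → y ∈ V region → x ∈ X ⊎ y ∈ X → e ∈ E region
    ∈E⁺ (inj₁ (refl , refl)) x∈ y∈ m         = ∈-compr⁺ InE? (∈V⁻ x∈ , ∈V⁻ y∈ , m)
    ∈E⁺ (inj₂ (refl , refl)) x∈ y∈ (inj₁ m) = ∈-compr⁺ InE? (∈V⁻ y∈ , ∈V⁻ x∈ , inj₂ m)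
    ∈E⁺ (inj₂ (refl , refl)) x∈ y∈ (inj₂ m) = ∈-compr⁺ InE? (∈V⁻ y∈ , ∈V⁻ x∈ , inj₁ m)

    ∈E⁻ : ∀ {e} → e ∈ E region → InE e
    ∈E⁻ = ∈-compr⁻ InE?

    arcs : Arcs (nV G)
    arcs = concatMap (λ e → (src G e , tgt G e) ∷ (tgt G e , src G e) ∷ []) (elements (E region))

    ∈arcs⁺ : ∀ {e x y} → e ∈ E region → Joins G e x y → (x , y) ∈ₗ arcs
    ∈arcs⁺ e∈ j = ∈-concatMap⁺ _ (Any.map (λ { refl → ends j }) (∈-elements e∈))
      where
      ends : ∀ {e x y} → Joins G e x y → (x , y) ∈ₗ (src G e , tgt G e) ∷ (tgt G e , src G e) ∷ []
      ends (inj₁ (refl , refl)) = here refl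
      ends (inj₂ (refl , refl)) = there (here refl)

    ∈arcs⁻ : ∀ {x y} → (x , y) ∈ₗ arcs → ∃ λ e → e ∈ E region × Joins G e x y
    ∈arcs⁻ a∈ with find (∈-concatMap⁻ _ {xs = elements (E region)} a∈)
    ... | e , e∈ , here refl         = e , elements-∈ e∈ , inj₁ (refl , refl)
    ... | e , e∈ , there (here refl) = e , elements-∈ e∈ , inj₂ (refl , refl)

    Linked : ℕ → Set
    Linked k = Linkage arcs (∂ B X) (∂ B Y) k

    infix 4 _≈_
    _≈_ : Fin (nV G) → Fin (nV G) → Set
    _≈_ = Conn G (_∈ V region) (_∈ E region)

    route-walk : ∀ {u v vs} → Route arcs u v vs → u ∈ V region →
      ∃ λ es → Walk G (_∈ V region) (_∈ E region) u v vs es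
    route-walk (here u)  u∈ = _ , stop u∈
    route-walk (via a r) u∈ with ∈arcs⁻ a
    ... | e , e∈ , j with closed region e e∈
    ... | s∈ , t∈ with j
    ... | inj₁ (refl , refl) = _ , step e u∈ e∈ j (proj₂ (route-walk r t∈))
    ... | inj₂ (refl , refl) = _ , step e u∈ e∈ j (proj₂ (route-walk r s∈))

    module _ {k} (L : Linked k) where
      open Linkage L

      start-∈V : ∀ i → start i ∈ V region
      start-∈V i = ∈V⁺ (inj₂ (start-∈ i))

      start≈end : ∀ i → start i ≈ end i
      start≈end i = _ , route-walk (route i) (start-∈V i)

      -- If the end of the route is still outside Z, its neighbour in Y lies in Z; otherwise the
      -- route itself enters Z.
      start-crossing : ∀ i Z → Y ⊆ Z → start i ∉ Z → ∃₂ λ x y → start i ≈ x × Adj x y × x ∉ Z × y ∈ Z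
      start-crossing i Z Y⊆Z s∉ with end i ∈? Z
      ... | yes end∈ = ∼-crossing Z (start≈end i) s∉ end∈
      ... | no end∉ with ∈∂⁻ (end-∈ i)
      ...   | _ , _ , y , y∈ , a = end i , y , start≈end i , a , end∉ , Y⊆Z y∈

  -- `ring` lets an edge skip a layer only if it leads from outside `Z 0` into `Z T`. `cut` provides
  -- nonempty boundaries, which excludes order 0.
  record Family (Z : ℕ → Subset (nV G)) (T k : ℕ) : Set where
    field
      nest  : ∀ j → Z (suc j) ⊆ Z j
      ring  : ∀ {x y} j → j < T → Adj x y → x ∉ Z j → y ∈ Z (suc j) → x ∉ Z 0 × y ∈ Z T
      order : ∀ j → 0 < j → j ≤ T → ∣ ∂ (Z 0) (Z j) ∣ ≤ k
      cut   : ∀ X → Z T ⊆ X → X ⊆ Z 1 → ∃ λ x → x ∈ ∂ (Z 0) X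

    nested : ∀ {i j} → i ≤ j → Z j ⊆ Z i
    nested {i} {zero}  z≤n = id
    nested {i} {suc j} i≤ with m≤n⇒m<n∨m≡n i≤
    ... | inj₁ i<   = nested (≤-pred i<) ∘ nest j
    ... | inj₂ refl = id

    ∂⊆predecessor : ∀ j → j < T → ∂ (Z 0) (Z (suc j)) ⊆ Z j
    ∂⊆predecessor j j< {x} x∈∂ with ∈∂⁻ x∈∂ | x ∈? Z j
    ... | _                   | yes x∈ = x∈
    ... | x∈0 , _ , y , y∈ , a | no x∉  = ⊥-elim (proj₁ (ring j j< a x∉ y∈) x∈0)

  open Family

  -- An edge skipping layer j of X skips layer `b j` of Z, because the index intervals of
  -- consecutive sets do not overlap. This serves both for passing to a subfamily and for building a
  -- family from new separators.
  interleave : ∀ {Z T k} → Family Z T k → ∀ (a b : ℕ → ℕ) T′ k′ (X : ℕ → Subset (nV G)) →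
    (∀ j → b j < a (suc j)) → b T′ ≤ T → (∀ j → j < T′ → b j < T) →
    (∀ j → Z (b j) ⊆ X j) → (∀ j → X j ⊆ Z (a j)) →
    (∀ j → 0 < j → j ≤ T′ → ∣ ∂ (Z 0) (X j) ∣ ≤ k′) → 0 < T′ → Family X T′ k′
  interleave {Z} F a b T′ k′ X b<a bT bj lo hi size T′>0 = record
    { nest  = λ j → lo j ∘ nested F (<⇒≤ (b<a j)) ∘ hi (suc j)
    ; ring  = λ j j<T′ e x∉ y∈ →
        let x∉0 , y∈T = ring F (b j) (bj j j<T′) e (x∉ ∘ lo j) (nested F (b<a j) (hi (suc j) y∈))
        in x∉0 ∘ X0⊆Z0 , lo T′ (nested F bT y∈T)
    ; order = λ j 0<j j≤ → ≤-trans
        (p⊆q⇒∣p∣≤∣q∣ (λ x∈ → let x∈0 , x∉ , y , y∈ , e = ∈∂⁻ x∈ in ∈∂⁺ (X0⊆Z0 x∈0) x∉ y∈ e))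
        (size j 0<j j≤)
    ; cut   = cut′ }
    where
    X0⊆Z0 : X 0 ⊆ Z 0
    X0⊆Z0 = nested F z≤n ∘ hi 0
    cut′ : ∀ W → X T′ ⊆ W → W ⊆ X 1 → ∃ λ x → x ∈ ∂ (X 0) W
    cut′ W XT⊆W W⊆X1
      with cut F W (XT⊆W ∘ lo T′ ∘ nested F bT) (nested F (≤-trans (s≤s z≤n) (b<a 0)) ∘ hi 1 ∘ W⊆X1)
    ... | x , x∈ with ∈∂⁻ x∈
    ... | x∈Z0 , x∉W , y , y∈W , e with x ∈? X 0
    ... | yes x∈X0 = x , ∈∂⁺ x∈X0 x∉W y∈W e
    ... | no  x∉X0 = ⊥-elim (proj₁ (ring F (b 0) (bj 0 T′>0) e (x∉X0 ∘ lo 0)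
                       (nested F (b<a 0) (hi 1 (W⊆X1 y∈W)))) x∈Z0)

  module Block {Z T k} (F : Family Z T k) (s t : ℕ) (1≤s : 1 ≤ s) (1≤t : 1 ≤ t) (t+s≤T : t + s ≤ T) where

    private
      X Y : Subset (nV G)
      X = Z s
      Y = Z (t + s)
      Y⊆X : Y ⊆ X
      Y⊆X = nested F (m≤n+m s t)
    open Region (Z 0) X Y public

    V⊆Z0 : V region ⊆ Z 0
    V⊆Z0 x∈ with ∈V⁻ x∈
    ... | inj₁ (x∈X , _) = nested F z≤n x∈X
    ... | inj₂ x∈∂       = proj₁ (∈∂⁻ x∈∂)

    V∉Y : ∀ {x} → x ∈ V region → x ∉ Y
    V∉Y x∈ with ∈V⁻ x∈
    ... | inj₁ (_ , x∉Y) = x∉Y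
    ... | inj₂ x∈∂       = proj₁ (proj₂ (∈∂⁻ x∈∂)) ∘ Y⊆X

    -- Menger's theorem between the two boundaries. A separator becomes the set W of Y together with
    -- X minus the side: a vertex just outside W then lies in the side, and is in the boundary of Y
    -- or sends an arc out of the side.
    linked-or-cut : ∀ m → Linked m ⊎ (∃ λ W → Y ⊆ W × W ⊆ X × ∣ ∂ (Z 0) W ∣ < m)
    linked-or-cut m with menger arcs (∂ (Z 0) X) (∂ (Z 0) Y) m
    ... | inj₁ L = inj₁ L
    ... | inj₂ sep = inj₂ (compr W? , (λ y∈ → ∈-compr⁺ W? (inj₁ y∈)) ,
        (λ x∈ → [ Y⊆X , proj₁ ]′ (∈-compr⁻ W? x∈)) , ≤-<-trans (p⊆q⇒∣p∣≤∣q∣ ∂W⊆bdry) small)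
      where
      open Separator sep
      W? : Decidable (λ x → x ∈ Y ⊎ (x ∈ X × x ∉ side))
      W? x = (x ∈? Y) ⊎-dec ((x ∈? X) ×-dec ¬? (x ∈? side))
      ∂W⊆bdry : ∂ (Z 0) (compr W?) ⊆ bdry
      ∂W⊆bdry {x} x∈∂ with ∈∂⁻ x∈∂
      ... | x∈0 , x∉W , y , y∈W , e , j = by-y (∈-compr⁻ W? y∈W)
        where
        x∉Y : x ∉ Y
        x∉Y x∈Y = x∉W (∈-compr⁺ W? (inj₁ x∈Y))
        y∈X : y ∈ X
        y∈X = [ Y⊆X , proj₁ ]′ (∈-compr⁻ W? y∈W)
        x∈side×V : x ∈ side × x ∈ V region
        x∈side×V with x ∈? X
        ... | no x∉X = let x∈∂X = ∈∂⁺ x∈0 x∉X y∈X (e , j) in A⊆side x∈∂X , ∈V⁺ (inj₂ x∈∂X)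
        ... | yes x∈X = decidable-stable (x ∈? side) (λ x∉side → x∉W (∈-compr⁺ W? (inj₂ (x∈X , x∉side)))) ,
                        ∈V⁺ (inj₁ (x∈X , x∉Y))
        by-y : y ∈ Y ⊎ (y ∈ X × y ∉ side) → x ∈ bdry
        by-y (inj₁ y∈Y) = B-bdry (proj₁ x∈side×V) (∈∂⁺ x∈0 x∉Y y∈Y (e , j))
        by-y (inj₂ (_ , y∉side)) with y ∈? Y
        ... | yes y∈Y = by-y (inj₁ y∈Y)
        ... | no  y∉Y = arc-bdry
          (∈arcs⁺ (∈E⁺ j (proj₂ x∈side×V) (∈V⁺ (inj₁ (y∈X , y∉Y))) (inj₂ y∈X)) j) (proj₁ x∈side×V) y∉side

    -- Restriction to the component C of start 0 inside the region. A path
    -- of the linkage outside C meets every boundary, so the order drops.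
    module Component {m} (k≤ : k ≤ suc m) (L : Linked (suc m)) where
      open Linkage L

      p : Fin (nV G)
      p = start zero

      p≈?_ : ∀ x → Dec (p ≈ x)
      p≈? x = p ∼?[ _∈? V region , _∈? E region ] x

      ≈-edge : ∀ {x y} → Adj x y → p ≈ x → y ∈ X → y ∉ Y → p ≈ y
      ≈-edge (e , j) p≈x y∈X y∉Y = let y∈V = ∈V⁺ (inj₁ (y∈X , y∉Y)) in
        ∼-snoc e p≈x (∈E⁺ j (∼-target p≈x) y∈V (inj₂ y∈X)) j y∈V

      -- Walks of G may leave the region, so the claim is carried along them as an implication. They
      -- can re-enter only at the boundary of X, which is reached by assumption, or at the boundary
      -- of Y, which the ends of the linkage exhaust.
      all-connected : Connected G → (∀ u → u ∈ ∂ (Z 0) X → p ≈ u) → ConnectedSub G region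
      all-connected (_ , conn) ∂X≈ = (p , start-∈V L zero) , λ u v u∈ v∈ →
        ∼-trans (∼-sym (all u u∈)) (all v v∈)
        where
        ∂Y≈ : ∀ v → v ∈ ∂ (Z 0) Y → p ≈ v
        ∂Y≈ v v∈ with injection-surjective (suc m) (∂ (Z 0) Y) end end-injective end-∈
                        (≤-trans (order F (t + s) (≤-trans 1≤t (m≤m+n t s)) t+s≤T) k≤) v v∈
        ... | i , refl = ∼-trans (∂X≈ (start i) (start-∈ i)) (start≈end L i)
        extend : ∀ {x y} → Adj x y → (x ∈ V region → p ≈ x) → y ∈ V region → p ≈ y
        extend {x} {y} a x≈ y∈ with ∈V⁻ y∈
        ... | inj₂ y∈∂ = ∂X≈ y y∈∂
        ... | inj₁ (y∈X , y∉Y) with x ∈? Z 0 | x ∈? X | x ∈? Y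
        ... | _        | _       | yes x∈Y = ∂Y≈ y (∈∂⁺ (V⊆Z0 y∈) y∉Y x∈Y (Adj-sym a))
        ... | _        | yes x∈X | no x∉Y  = ≈-edge a (x≈ (∈V⁺ (inj₁ (x∈X , x∉Y)))) y∈X y∉Y
        ... | yes x∈Z0 | no x∉X  | _       = ≈-edge a (x≈ (∈V⁺ (inj₂ (∈∂⁺ x∈Z0 x∉X y∈X a)))) y∈X y∉Y
        ... | no x∉Z0  | no x∉X  | _       = ⊥-elim (y∉Y (nested F t+s≤T (wraps s 1≤s (≤-trans (m≤n+m s t) t+s≤T) y∈X)))
          where
          -- From outside `Z 0` into `Z s`, the edge skips the layer just before s.
          wraps : ∀ s → 1 ≤ s → s ≤ T → y ∈ Z s → y ∈ Z T
          wraps (suc s′) _ s≤T y∈ = proj₂ (ring F s′ s≤T a (x∉Z0 ∘ nested F z≤n) y∈)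
        all : ∀ v → v ∈ V region → p ≈ v
        all v = ∼-closed {S = λ x → x ∈ V region → p ≈ x} (λ e Sx _ _ _ j → extend (e , j) Sx)
                  (λ _ → ∼-refl (start-∈V L zero)) (conn p v tt tt)

      -- Y is kept whole in every set: an edge from a discarded vertex into Y then skips all layers,
      -- as `ring` permits.
      Restrict? : ∀ j → Decidable (λ x → x ∈ Y ⊎ (x ∈ Z (j + s) × p ≈ x))
      Restrict? j x = (x ∈? Y) ⊎-dec ((x ∈? Z (j + s)) ×-dec (p≈? x))

      restrict : ℕ → Subset (nV G)
      restrict j = compr (Restrict? j)

      Y⊆restrict : ∀ j → Y ⊆ restrict j
      Y⊆restrict j y∈ = ∈-compr⁺ (Restrict? j) (inj₁ y∈)

      ∈restrict : ∀ j {x} → x ∈ Z (j + s) → p ≈ x → x ∈ restrict j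
      ∈restrict j x∈ p≈x = ∈-compr⁺ (Restrict? j) (inj₂ (x∈ , p≈x))

      restrict⊆Z : ∀ {j} → j ≤ t → restrict j ⊆ Z (j + s)
      restrict⊆Z {j} j≤t x∈ = [ nested F (+-monoˡ-≤ s j≤t) , proj₁ ]′ (∈-compr⁻ (Restrict? j) x∈)

      reduced : ∀ u → u ∈ ∂ (Z 0) X → ¬ p ≈ u → Family restrict t m
      reduced u u∈∂ p≉u = record
        { nest  = λ j x∈ → ∈-compr⁺ (Restrict? j) (map₂ (λ (x∈Z , p≈x) → nest F (j + s) x∈Z , p≈x) (∈-compr⁻ (Restrict? (suc j)) x∈))
        ; ring  = λ j j<t a x∉ y∈ → ring′ j j<t a x∉ y∈ (∈-compr⁻ (Restrict? (suc j)) y∈)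
        ; order = order′
        ; cut   = cut′ }
        where
        j+s<T : ∀ {j} → j < t → j + s < T
        j+s<T j<t = ≤-trans (+-monoˡ-≤ s j<t) t+s≤T
        ring′ : ∀ {x y} j → j < t → Adj x y → x ∉ restrict j → y ∈ restrict (suc j) →
          y ∈ Y ⊎ (y ∈ Z (suc j + s) × p ≈ y) → x ∉ restrict 0 × y ∈ restrict t
        ring′ {x} j j<t a x∉ y∈ (inj₁ y∈Y) = x∉0 , Y⊆restrict t y∈Y
          where
          x∉0 : x ∉ restrict 0
          x∉0 x∈ with ∈-compr⁻ (Restrict? 0) x∈
          ... | inj₁ x∈Y         = x∉ (Y⊆restrict j x∈Y)
          ... | inj₂ (x∈X , p≈x) = proj₁ (ring F (j + s) (j+s<T j<t) a (λ x∈Z → x∉ (∈restrict j x∈Z p≈x))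
                                     (restrict⊆Z j<t y∈)) (nested F z≤n x∈X)
        ring′ {x} {y} j j<t a x∉ y∈ (inj₂ (y∈Z , p≈y)) with x ∈? Z (j + s)
        ... | no x∉Z  = ⊥-elim (V∉Y (∼-target p≈y) (nested F t+s≤T (proj₂ (ring F (j + s) (j+s<T j<t) a x∉Z y∈Z))))
        ... | yes x∈Z = ⊥-elim (x∉ (∈restrict j x∈Z
                          (≈-edge (Adj-sym a) p≈y (nested F (m≤n+m s j) x∈Z) (x∉ ∘ Y⊆restrict j))))
        found = injection-surjective (suc m) (∂ (Z 0) X) start start-injective start-∈
                  (≤-trans (order F s 1≤s (≤-trans (m≤n+m s t) t+s≤T)) k≤) u u∈∂
        i = proj₁ found
        p≉start : ¬ p ≈ start i
        p≉start = subst (λ v → ¬ p ≈ v) (sym (proj₂ found)) p≉u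
        start∉ : ∀ i j → start i ∉ Z (j + s)
        start∉ i j s∈ = proj₁ (proj₂ (∈∂⁻ (start-∈ i))) (nested F (m≤n+m s j) s∈)
        order′ : ∀ j → 0 < j → j ≤ t → ∣ ∂ (restrict 0) (restrict j) ∣ ≤ m
        -- The path from u crosses into `Z (j + s)` at a vertex q outside the component, which
        -- counts for the old boundary but not for the restricted one.
        order′ j 0<j j≤t with start-crossing L i (Z (j + s)) (nested F (+-monoˡ-≤ s j≤t)) (start∉ i j)
        ... | q , y , start≈q , a , q∉ , y∈ = ≤-pred (<-≤-trans
            (p⊂q⇒∣p∣<∣q∣ ((λ x∈ → ∂⊆ x∈) , q , ∈∂⁺ (V⊆Z0 (∼-target start≈q)) q∉ y∈ a , q∉∂))
            (≤-trans (order F (j + s) (≤-trans 0<j (m≤m+n j s)) (≤-trans (+-monoˡ-≤ s j≤t) t+s≤T)) k≤))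
          where
          ∂-reached : ∀ {x} → x ∈ ∂ (restrict 0) (restrict j) → p ≈ x
          ∂-reached x∈ with ∈∂⁻ x∈
          ... | x∈0 , x∉ , _ with ∈-compr⁻ (Restrict? 0) x∈0
          ... | inj₁ x∈Y       = ⊥-elim (x∉ (Y⊆restrict j x∈Y))
          ... | inj₂ (_ , p≈x) = p≈x
          ∂⊆ : ∂ (restrict 0) (restrict j) ⊆ ∂ (Z 0) (Z (j + s))
          ∂⊆ x∈ with ∈∂⁻ x∈
          ... | x∈0 , x∉ , y , y∈ , a = ∈∂⁺ (nested F z≤n (restrict⊆Z z≤n x∈0))
                (λ x∈Z → x∉ (∈restrict j x∈Z (∂-reached x∈))) (restrict⊆Z j≤t y∈) a
          q∉∂ : q ∉ ∂ (restrict 0) (restrict j)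
          q∉∂ q∈ = p≉start (∼-trans (∂-reached q∈) (∼-sym start≈q))
        cut′ : ∀ W → restrict t ⊆ W → W ⊆ restrict 1 → ∃ λ x → x ∈ ∂ (restrict 0) W
        -- The path from p stays in the component, and its end has a neighbour in Y, hence in W; so
        -- some step enters W.
        cut′ W t⊆W W⊆1 with start-crossing L zero W (t⊆W ∘ Y⊆restrict t) (start∉ zero 1 ∘ restrict⊆Z 1≤t ∘ W⊆1)
        ... | x , y , p≈x , a , x∉W , y∈W with x ∈? X
        ... | yes x∈X = x , ∈∂⁺ (∈restrict 0 x∈X p≈x) x∉W y∈W a
        ... | no  x∉X = ⊥-elim (proj₁ (ring F s (j+s<T 1≤t) a x∉X (restrict⊆Z 1≤t (W⊆1 y∈W)))
                          (V⊆Z0 (∼-target p≈x)))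

      connected-or-reduced : Connected G → ConnectedSub G region ⊎ (∃ λ Z′ → Family Z′ t m)
      connected-or-reduced conn with Finₚ.any? (λ u → (u ∈? ∂ (Z 0) X) ×-dec ¬? (p≈? u))
      ... | yes (u , u∈ , p≉u) = inj₂ (restrict , reduced u u∈ p≉u)
      ... | no none = inj₁ (all-connected conn
              (λ u u∈ → decidable-stable (p≈? u) (λ p≉u → none (u , u∈ , p≉u))))

-- The induction on the order

all-or-some : ∀ {P Q : ℕ → Set} m → (∀ j → j < m → P j ⊎ Q j) →
  (∀ j → j < m → P j) ⊎ (∃ λ j → j < m × Q j)
all-or-some zero    f = inj₁ (λ _ ())
all-or-some {P} (suc m) f with all-or-some m (λ j j<m → f j (≤-trans j<m (n≤1+n m)))
... | inj₂ (j , j<m , q) = inj₂ (j , ≤-trans j<m (n≤1+n m) , q)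
... | inj₁ ps with f m ≤-refl
...   | inj₂ q = inj₂ (m , ≤-refl , q)
...   | inj₁ p = inj₁ ps′
  where
  ps′ : ∀ j → j < suc m → P j
  ps′ j j<1+m with m≤n⇒m<n∨m≡n (≤-pred j<1+m)
  ... | inj₁ j<m  = ps j j<m
  ... | inj₂ refl = p

-- An arithmetic progression, defined by recursion so that consecutive rungs have the form `t + s`
-- required by `Block`.
ladder : ℕ → ℕ → ℕ → ℕ
ladder c M zero    = c
ladder c M (suc i) = M + ladder c M i

ladder≡ : ∀ c M i → ladder c M i ≡ i * M + c
ladder≡ c M zero    = refl
ladder≡ c M (suc i) = trans (cong (M +_) (ladder≡ c M i)) (sym (+-assoc M (i * M) c))

ladder-mono : ∀ c M {i j} → i ≤ j → ladder c M i ≤ ladder c M j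
ladder-mono c M {i} {j} i≤j rewrite ladder≡ c M i | ladder≡ c M j = +-monoˡ-≤ c (*-monoˡ-≤ M i≤j)

-- With M the length needed for the smaller order, there are M + 1 blocks of n pieces of length M.
-- The additional index per block keeps the blocks strictly apart, and M + 1 cuts form a family of
-- length M.
family-length : ℕ → ℕ → ℕ
family-length zero    n = 1
family-length (suc k) n = suc (family-length k n) * suc (n * family-length k n)

family-length>0 : ∀ k n → 1 ≤ family-length k n
family-length>0 zero    n = ≤-refl
family-length>0 (suc k) n = s≤s z≤n

module _ (G : Multigraph) where
  open Family

  -- `Y 0` serves as the ambient set of all boundaries, so the pieces start at index 1.
  record LinkedFamily (n k : ℕ) : Set where
    field
      Y         : ℕ → Subset (nV G)
      family    : Family G Y (suc n) k
      linked    : ∀ j → j < n → Region.Linked G (Y 0) (Y (suc j)) (Y (2 + j)) k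
      connected : ∀ j → j < n → ConnectedSub G (Region.region G (Y 0) (Y (suc j)) (Y (2 + j)))

  module Step (conn : Connected G) {Z n k} (F : Family G Z (family-length (suc k) n) (suc k)) where

    M L T : ℕ
    M = family-length k n
    L = n * M
    T = family-length (suc k) n

    lo hi : ℕ → ℕ
    lo j = suc (j * suc L)
    hi j = ladder (lo j) M n

    hi≡ : ∀ j → hi j ≡ L + lo j
    hi≡ j = ladder≡ (lo j) M n

    hi<lo : ∀ j → hi j < lo (suc j)
    hi<lo j rewrite hi≡ j = s≤s (≤-reflexive (+-suc L (j * suc L)))

    hi≤T : ∀ j → j ≤ M → hi j ≤ T
    hi≤T j j≤M = ≤-pred (≤-trans (hi<lo j) (s≤s (*-monoˡ-≤ (suc L) (s≤s j≤M))))

    hi<T : ∀ j → j < M → hi j < T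
    hi<T j j<M = ≤-trans (hi<lo j) (≤-trans (s≤s (m≤n+m (suc j * suc L) L)) (*-monoˡ-≤ (suc L) (s≤s j<M)))

    Cut : ℕ → Set
    Cut j = ∃ λ W → Z (hi j) ⊆ W × W ⊆ Z (lo j) × ∣ ∂ G (Z 0) W ∣ < suc k

    module Sub (j : ℕ) (j≤M : j ≤ M) (i : ℕ) (i<n : i < n) =
      Block G F (ladder (lo j) M i) M (≤-trans (s≤s z≤n) (ladder-mono (lo j) M {0} {i} z≤n)) (family-length>0 k n)
        (≤-trans (ladder-mono (lo j) M {suc i} {n} i<n) (hi≤T j j≤M))

    LinkedAt : ℕ → ℕ → Set
    LinkedAt j i = Region.Linked G (Z 0) (Z (ladder (lo j) M i)) (Z (ladder (lo j) M (suc i))) (suc k)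

    linked-or-cut : ∀ j → j ≤ M → (∀ i → i < n → LinkedAt j i) ⊎ Cut j
    linked-or-cut j j≤M with all-or-some {Q = λ i → Cut j} n (λ i i<n →
        map₂ (λ (W , lower , upper , small) → W ,
                lower ∘ nested F (ladder-mono (lo j) M i<n) ,
                nested F (ladder-mono (lo j) M {0} {i} z≤n) ∘ upper , small)
          (Sub.linked-or-cut j j≤M i i<n (suc k)))
    ... | inj₁ linked          = inj₁ linked
    ... | inj₂ (_ , _ , cut-j) = inj₂ cut-j

    recut : (∀ j → j < suc M → Cut j) → ∃ λ Z′ → Family G Z′ M k
    recut cuts = X , interleave G F lo hi M k X hi<lo (hi≤T M ≤-refl) hi<T
        (λ j → proj₁ (X-between j)) (λ j → proj₂ (X-between j)) X-small (family-length>0 k n)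
      where
      X : ℕ → Subset (nV G)
      X j with j <? suc M
      ... | yes j< = proj₁ (cuts j j<)
      -- A default beyond M that respects the bounds, as a family has to be nested at all indices.
      ... | no  _  = Z (hi j)
      X-between : ∀ j → Z (hi j) ⊆ X j × X j ⊆ Z (lo j)
      X-between j with j <? suc M
      ... | yes j< = let _ , lower , upper , _ = cuts j j< in lower , upper
      ... | no  _  = id , nested F (ladder-mono (lo j) M {0} {n} z≤n)
      X-small : ∀ j → 0 < j → j ≤ M → ∣ ∂ G (Z 0) (X j) ∣ ≤ k
      X-small j _ j≤M with j <? suc M
      ... | yes j< = let _ , _ , _ , small = cuts j j< in ≤-pred small
      ... | no  j≮ = ⊥-elim (j≮ (s≤s j≤M))

    -- If every block has a cut, the cuts form a family of smaller order. Otherwise some block is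
    -- linked in all its pieces, and a disconnected piece, having length M, again yields a family of
    -- smaller order.
    result : (∃ λ Z′ → Family G Z′ M k) ⊎ LinkedFamily n (suc k)
    result with all-or-some (suc M) (λ j j< → swap (map₁ (λ l → ≤-pred j< , l) (linked-or-cut j (≤-pred j<))))
    ... | inj₁ cuts = inj₁ (recut cuts)
    ... | inj₂ (j , _ , j≤M , links)
      with all-or-some n (λ i i<n → Sub.Component.connected-or-reduced j j≤M i i<n ≤-refl (links i i<n) conn)
    ...   | inj₂ (_ , _ , reduced) = inj₁ reduced
    ...   | inj₁ conns = inj₂ record
      { Y = Z ∘ at
      ; family = interleave G F at at (suc n) (suc k) (Z ∘ at) at< (hi≤T j j≤M) at-bound
          (λ _ → id) (λ _ → id) at-order (s≤s z≤n)
      ; linked = links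
      ; connected = conns }
      where
      at : ℕ → ℕ
      -- Keeping `Z 0` in front leaves the ambient set, and with it boundaries and regions,
      -- unchanged.
      at zero    = 0
      at (suc i) = ladder (lo j) M i
      at< : ∀ i → at i < at (suc i)
      at< zero    = s≤s z≤n
      at< (suc i) = +-monoˡ-≤ (ladder (lo j) M i) (family-length>0 k n)
      at-mono : ∀ {i i′} → i ≤ i′ → at i ≤ at i′
      at-mono {zero}             _          = z≤n
      at-mono {suc i} {suc i′} (s≤s i≤i′) = ladder-mono (lo j) M i≤i′
      at-bound : ∀ i → i < suc n → at i < T
      at-bound i i< = <-≤-trans (at< i) (≤-trans (at-mono i<) (hi≤T j j≤M))
      at-order : ∀ i → 0 < i → i ≤ suc n → ∣ ∂ G (Z 0) (Z (at i)) ∣ ≤ suc k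
      at-order (suc i) _ i≤ = order F (at (suc i)) (≤-trans (s≤s z≤n) (at< i)) (≤-trans (at-mono i≤) (hi≤T j j≤M))

  linked-family : Connected G → ∀ k n Z → Family G Z (family-length k n) k → ∃ λ k′ → k′ ≤ k × LinkedFamily n k′
  -- Order 0 is impossible, since `cut` gives a vertex in the boundary of `Z 1`.
  linked-family conn zero n Z F with cut F (Z 1) id id
  ... | x , x∈ = ⊥-elim (<-irrefl refl (<-≤-trans (≤-<-trans z≤n (x∈p⇒∣p-x∣<∣p∣ x∈)) (order F 1 ≤-refl ≤-refl)))
  linked-family conn (suc k) n Z F with Step.result conn F
  ... | inj₂ linked = suc k , ≤-refl , linked
  ... | inj₁ (Z′ , F′) = let k′ , k′≤k , linked = linked-family conn k n Z′ F′ in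
    k′ , ≤-trans k′≤k (n≤1+n k) , linked

-- From a linked family to a ring-decomposition

cnext-view : ∀ {n} (i : Fin (suc n)) →
  (toℕ i ≡ n × cnext i ≡ zero) ⊎ (toℕ i < n × toℕ (cnext i) ≡ suc (toℕ i))
cnext-view {zero}  zero = inj₁ (refl , refl)
cnext-view {suc n} zero = inj₂ (s≤s z≤n , refl)
cnext-view {suc n} (suc i) with cnext {n} i | cnext-view i
... | zero  | inj₁ (eq , _)  = inj₁ (cong suc eq , refl)
... | suc j | inj₂ (lt , eq) = inj₂ (s≤s lt , cong suc eq)
... | zero  | inj₂ (_ , ())
... | suc j | inj₁ (_ , ())

module Assembly (G : Multigraph) {n k : ℕ} (3≤n : 3 ≤ n) (R : LinkedFamily G n k) where
  open LinkedFamily R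
  open Family family

  module Slab (j : ℕ) = Region G (Y 0) (Y (suc j)) (Y (2 + j))

  slab : ℕ → Subgraph G
  slab j = Slab.region j

  module _ {j x} (j<n : j < n) (x∈ : x ∈ V (slab j)) where

    slab⊆ : x ∈ Y j
    slab⊆ with Slab.∈V⁻ j x∈
    ... | inj₁ (x∈Y , _) = nest j x∈Y
    ... | inj₂ x∈∂       = ∂⊆predecessor j (≤-trans j<n (n≤1+n n)) x∈∂

    slab-avoids : x ∉ Y (2 + j)
    slab-avoids with Slab.∈V⁻ j x∈
    ... | inj₁ (_ , x∉Y) = x∉Y
    ... | inj₂ x∈∂       = proj₁ (proj₂ (∈∂⁻ G x∈∂)) ∘ nest (suc j)

  InSlabEdge : Fin (nE G) → Set
  InSlabEdge e = ∃ λ (j : Fin n) → e ∈ E (slab (toℕ j))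

  InSlabEdge? : Decidable InSlabEdge
  InSlabEdge? e = Finₚ.any? (λ j → e ∈? E (slab (toℕ j)))

  -- The first boundary is already outside `Y 1`, so only the last one has to be added.
  Outer : Fin (nV G) → Set
  Outer x = x ∉ Y 1 ⊎ x ∈ Y (suc n) ⊎ x ∈ ∂ G (Y 0) (Y (suc n))

  Outer? : Decidable Outer
  Outer? x = ¬? (x ∈? Y 1) ⊎-dec (x ∈? Y (suc n)) ⊎-dec (x ∈? ∂ G (Y 0) (Y (suc n)))

  level : ∀ m {x} → x ∈ Y 1 → x ∉ Y (suc m) → ∃ λ j → j < m × x ∈ Y (suc j) × x ∉ Y (2 + j)
  level zero    x∈ x∉ = ⊥-elim (x∉ x∈)
  level (suc m) {x} x∈ x∉ with x ∈? Y (suc m)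
  ... | yes x∈m = m , ≤-refl , x∈m , x∉
  ... | no  x∉m = let j , j<m , r = level m x∈ x∉m in j , ≤-trans j<m (n≤1+n m) , r

  outer-or-level : ∀ x → Outer x ⊎
    (x ∉ ∂ G (Y 0) (Y (suc n)) × ∃ λ j → j < n × x ∈ Y (suc j) × x ∉ Y (2 + j))
  outer-or-level x with Outer? x
  ... | yes o = inj₁ o
  ... | no ¬o = inj₂ (¬o ∘ inj₂ ∘ inj₂ ,
      level n (decidable-stable (x ∈? Y 1) (¬o ∘ inj₁)) (¬o ∘ inj₂ ∘ inj₁))

  slab-edge : ∀ {e x y} j → j < n → Joins G e x y → x ∈ V (slab j) → y ∈ V (slab j) →
    x ∈ Y (suc j) ⊎ y ∈ Y (suc j) → InSlabEdge e
  slab-edge {e} j j<n J x∈ y∈ m = fromℕ< j<n ,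
    subst (λ i → e ∈ E (slab i)) (sym (Finₚ.toℕ-fromℕ< j<n)) (Slab.∈E⁺ j J x∈ y∈ m)

  -- If x is at level j, the other end decides the slab of e: the same slab, or the next one if y
  -- lies deeper. An edge leading outside `Y 0` skips layer j, which puts x into `Y (suc n)`.
  end-outer : ∀ {e x y} → Joins G e x y → ¬ InSlabEdge e → Outer x
  end-outer {e} {x} {y} J ¬slab with outer-or-level x
  ... | inj₁ o = o
  ... | inj₂ (x∉∂ , j , j<n , x∈Y , x∉Y) with y ∈? Y (suc j) | y ∈? Y (2 + j) | y ∈? Y 0
  ... | yes y∈1 | no y∉2 | _ = ⊥-elim (¬slab (slab-edge j j<n J
          (Slab.∈V⁺ j (inj₁ (x∈Y , x∉Y))) (Slab.∈V⁺ j (inj₁ (y∈1 , y∉2))) (inj₁ x∈Y)))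
  ... | no y∉1 | _ | yes y∈0 = ⊥-elim (¬slab (slab-edge j j<n J
          (Slab.∈V⁺ j (inj₁ (x∈Y , x∉Y)))
          (Slab.∈V⁺ j (inj₂ (∈∂⁺ G y∈0 y∉1 x∈Y (e , Joins-sym {G} J)))) (inj₁ x∈Y)))
  ... | no y∉1 | _ | no y∉0 = inj₂ (inj₁ (proj₂ (ring j (≤-trans j<n (n≤1+n n)) (e , Joins-sym {G} J) (y∉0 ∘ nested z≤n) x∈Y)))
  ... | yes _ | yes y∈2 | _ with m≤n⇒m<n∨m≡n j<n
  ...   | inj₂ refl = ⊥-elim (x∉∂ (∈∂⁺ G (nested z≤n x∈Y) x∉Y y∈2 (e , J)))
  ...   | inj₁ 1+j<n = ⊥-elim (¬slab (slab-edge (suc j) 1+j<n J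
          (Slab.∈V⁺ (suc j) (inj₂ (∈∂⁺ G (nested z≤n x∈Y) x∉Y y∈2 (e , J))))
          (Slab.∈V⁺ (suc j) (inj₁ (y∈2 , y∉3))) (inj₂ y∈2)))
    where
    y∉3 : y ∉ Y (3 + j)
    y∉3 y∈3 = proj₁ (ring (2 + j) (s≤s 1+j<n) (e , J) x∉Y y∈3) (nested z≤n x∈Y)

  rest : Subgraph G
  rest = record
    { V = compr Outer? ; E = compr (λ e → ¬? (InSlabEdge? e))
    ; closed = λ e e∈ → let ¬slab = ∈-compr⁻ (λ e → ¬? (InSlabEdge? e)) e∈ in
        ∈-compr⁺ Outer? (end-outer (inj₁ (refl , refl)) ¬slab) ,
        ∈-compr⁺ Outer? (end-outer (inj₂ (refl , refl)) ¬slab) }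

  piece : ℕ → Subgraph G
  piece zero    = rest
  piece (suc j) = slab j

  -- Outer vertices lie outside `Y 1` or inside `Y n`, whereas slab j lies in `Y 1` and avoids
  -- `Y (2 + j)`, which contains `Y n`.
  rest-avoids : ∀ {x} j → 1 ≤ j → suc j < n → x ∈ V rest → x ∈ V (slab j) → ⊥
  rest-avoids j 1≤j 1+j<n x∈r x∈s with ∈-compr⁻ Outer? x∈r
  ... | inj₁ x∉1        = x∉1 (nested 1≤j (slab⊆ (<⇒≤ 1+j<n) x∈s))
  ... | inj₂ (inj₁ x∈n) = slab-avoids (<⇒≤ 1+j<n) x∈s (nested (≤-trans 1+j<n (n≤1+n n)) x∈n)
  ... | inj₂ (inj₂ x∈∂) = slab-avoids (<⇒≤ 1+j<n) x∈s (nested 1+j<n (∂⊆predecessor n ≤-refl x∈∂))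

  part : Fin (suc n) → Subgraph G
  part i = piece (toℕ i)

  next-piece : ∀ i → (toℕ i ≡ n × part (cnext i) ≡ rest) ⊎ (toℕ i < n × part (cnext i) ≡ slab (toℕ i))
  next-piece i with cnext-view i
  ... | inj₁ (i≡n , eq) = inj₁ (i≡n , cong part eq)
  ... | inj₂ (i<n , eq) = inj₂ (i<n , cong piece eq)

  slabs-edge-disjoint : ∀ {e} j → j < n → e ∈ E (slab j) → e ∈ E (slab (suc j)) → ⊥
  slabs-edge-disjoint j j<n e∈ e∈′ with closed (slab j) _ e∈ | Slab.∈E⁻ (suc j) e∈′
  ... | s , _ | _ , _ , inj₁ s∈Y = slab-avoids j<n s s∈Y
  ... | _ , t | _ , _ , inj₂ t∈Y = slab-avoids j<n t t∈Y

  rest-edge-disjoint : ∀ {e} j → j < n → e ∈ E rest → e ∈ E (slab j) → ⊥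
  rest-edge-disjoint {e} j j<n e∈r e∈s = ∈-compr⁻ (λ e → ¬? (InSlabEdge? e)) e∈r
    (fromℕ< j<n , subst (λ i → e ∈ E (slab i)) (sym (Finₚ.toℕ-fromℕ< j<n)) e∈s)

  consec : ∀ i e → e ∈ E (part i) → e ∈ E (part (cnext i)) → ⊥
  consec i e e∈ e∈′ with toℕ i | next-piece i
  ... | zero  | inj₁ (refl , _)  = ⊥-elim (<-irrefl refl (≤-trans (s≤s z≤n) 3≤n))
  ... | suc j | inj₁ (refl , eq) = rest-edge-disjoint j ≤-refl (subst (λ H → e ∈ E H) eq e∈′) e∈
  ... | zero  | inj₂ (0<n , eq)  = rest-edge-disjoint 0 0<n e∈ (subst (λ H → e ∈ E H) eq e∈′)
  ... | suc j | inj₂ (j<n , eq)  = slabs-edge-disjoint j (<⇒≤ j<n) e∈ (subst (λ H → e ∈ E H) eq e∈′)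

  -- The condition on 0 and n exempts the first and last pieces, the only cyclic neighbours whose
  -- indices are far apart.
  pieces-disjoint : ∀ i j → suc i < j → j ≤ n → (i ≡ 0 → j ≢ n) → ∀ v → v ∈ V (piece i) → v ∈ V (piece j) → ⊥
  pieces-disjoint zero    (suc j) (s≤s 1≤j)   j<n j≢n v v∈i v∈j with m≤n⇒m<n∨m≡n j<n
  ... | inj₁ 1+j<n = rest-avoids j 1≤j 1+j<n v∈i v∈j
  ... | inj₂ eq    = j≢n refl eq
  pieces-disjoint (suc i) (suc j) (s≤s 1+i<j) j<n _   v v∈i v∈j =
    slab-avoids (≤-trans (s≤s (≤-trans (n≤1+n i) (<⇒≤ 1+i<j))) j<n) v∈i (nested 1+i<j (slab⊆ j<n v∈j))

  ordered-disjoint : ∀ (i j : Fin (suc n)) → toℕ i < toℕ j → cnext i ≢ j → cnext j ≢ i →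
    ∀ v → v ∈ V (part i) → v ∈ V (part j) → ⊥
  ordered-disjoint i j i<j i+1≢j j+1≢i = pieces-disjoint (toℕ i) (toℕ j) 1+i<j (Finₚ.toℕ≤pred[n] j) ends
    where
    1+i<j : suc (toℕ i) < toℕ j
    1+i<j with m≤n⇒m<n∨m≡n i<j | cnext-view i
    ... | inj₁ lt | _               = lt
    ... | inj₂ eq | inj₂ (_ , next) = ⊥-elim (i+1≢j (Finₚ.toℕ-injective (trans next eq)))
    ... | inj₂ eq | inj₁ (i≡n , _)  = ⊥-elim (<-irrefl i≡n (≤-trans i<j (Finₚ.toℕ≤pred[n] j)))
    ends : toℕ i ≡ 0 → toℕ j ≢ n
    ends i≡0 j≡n with cnext-view j
    ... | inj₁ (_ , next) = j+1≢i (trans next (Finₚ.toℕ-injective (sym i≡0)))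
    ... | inj₂ (j<n , _)  = <-irrefl j≡n j<n

  nonconsec : ∀ i j → i ≢ j → cnext i ≢ j → cnext j ≢ i → ∀ v → v ∈ V (part i) → v ∈ V (part j) → ⊥
  nonconsec i j i≢j p q v v∈i v∈j with <-cmp (toℕ i) (toℕ j)
  ... | tri< i<j _ _ = ordered-disjoint i j i<j p q v v∈i v∈j
  ... | tri≈ _ i≡j _ = i≢j (Finₚ.toℕ-injective i≡j)
  ... | tri> _ _ j<i = ordered-disjoint j i j<i q p v v∈j v∈i

  common : Fin (suc n) → Subset (nV G)
  common i = V (part i) ∩ V (part (cnext i))

  boundary : ℕ → Subset (nV G)
  boundary j = ∂ G (Y 0) (Y (suc j))

  slab∩slab : ∀ j → suc j < n → V (slab j) ∩ V (slab (suc j)) ≡ boundary (suc j)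
  slab∩slab j 1+j<n = ⊆-antisym
    (λ x∈ → let x∈l , x∈r = x∈p∩q⁻ _ _ x∈ in
      [ (λ (x∈Y , _) → ⊥-elim (slab-avoids (<⇒≤ 1+j<n) x∈l x∈Y)) , id ]′ (Slab.∈V⁻ (suc j) x∈r))
    (λ x∈∂ → x∈p∩q⁺
      ( Slab.∈V⁺ j (inj₁ (∂⊆predecessor (suc j) (≤-trans 1+j<n (n≤1+n n)) x∈∂ , proj₁ (proj₂ (∈∂⁻ G x∈∂))))
      , Slab.∈V⁺ (suc j) (inj₂ x∈∂)))

  rest∩slab : V rest ∩ V (slab 0) ≡ boundary 0
  rest∩slab = ⊆-antisym
    (λ x∈ → let x∈r , x∈s = x∈p∩q⁻ _ _ x∈ in first x∈s (∈-compr⁻ Outer? x∈r) (Slab.∈V⁻ 0 x∈s))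
    (λ x∈∂ → x∈p∩q⁺ (∈-compr⁺ Outer? (inj₁ (proj₁ (proj₂ (∈∂⁻ G x∈∂)))) , Slab.∈V⁺ 0 (inj₂ x∈∂)))
    where
    0<n : 0 < n
    0<n = ≤-trans (s≤s z≤n) 3≤n
    first : ∀ {x} → x ∈ V (slab 0) → Outer x → Slab.InV 0 x → x ∈ boundary 0
    first _ _ (inj₂ x∈∂) = x∈∂
    first _ (inj₁ x∉) (inj₁ (x∈ , _)) = ⊥-elim (x∉ x∈)
    first x∈s (inj₂ (inj₁ x∈n)) _ = ⊥-elim (slab-avoids 0<n x∈s (nested (≤-trans (≤-trans (n≤1+n 2) 3≤n) (n≤1+n n)) x∈n))
    first x∈s (inj₂ (inj₂ x∈∂)) _ = ⊥-elim (slab-avoids 0<n x∈s (nested (≤-trans (n≤1+n 2) 3≤n) (∂⊆predecessor n ≤-refl x∈∂)))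

  slab∩rest : ∀ j → suc j ≡ n → V (slab j) ∩ V rest ≡ boundary (suc j)
  slab∩rest j refl = ⊆-antisym
    (λ x∈ → let x∈s , x∈r = x∈p∩q⁻ _ _ x∈ in last x∈s (∈-compr⁻ Outer? x∈r))
    (λ x∈∂ → x∈p∩q⁺
      ( Slab.∈V⁺ j (inj₁ (∂⊆predecessor (suc j) ≤-refl x∈∂ , proj₁ (proj₂ (∈∂⁻ G x∈∂))))
      , ∈-compr⁺ Outer? (inj₂ (inj₂ x∈∂))))
    where
    last : ∀ {x} → x ∈ V (slab j) → Outer x → x ∈ boundary (suc j)
    last x∈s (inj₁ x∉1)        = ⊥-elim (x∉1 (nested (≤-pred (≤-trans (n≤1+n 2) 3≤n)) (slab⊆ ≤-refl x∈s)))
    last x∈s (inj₂ (inj₁ x∈n)) = ⊥-elim (slab-avoids ≤-refl x∈s x∈n)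
    last x∈s (inj₂ (inj₂ x∈∂)) = x∈∂

  common≡boundary : ∀ i → common i ≡ boundary (toℕ i)
  common≡boundary i with toℕ i | next-piece i
  ... | zero  | inj₁ (refl , _)   = ⊥-elim (<-irrefl refl (≤-trans (s≤s z≤n) 3≤n))
  ... | suc j | inj₁ (eq , next)  = trans (cong (λ H → V (slab j) ∩ V H) next) (slab∩rest j eq)
  ... | zero  | inj₂ (_ , next)   = trans (cong (λ H → V rest ∩ V H) next) rest∩slab
  ... | suc j | inj₂ (j<n , next) = trans (cong (λ H → V (slab j) ∩ V H) next) (slab∩slab j j<n)

  -- The lower bound comes from the distinct starts of the first linkage and the distinct ends of
  -- each linkage.
  boundary-size : ∀ j → j ≤ n → ∣ boundary j ∣ ≡ k
  boundary-size j j≤n = ≤-antisym (order (suc j) (s≤s z≤n) (s≤s j≤n)) (large j j≤n)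
    where
    large : ∀ j → j ≤ n → k ≤ ∣ boundary j ∣
    large zero    _   = let open Linkage (linked 0 (≤-trans (s≤s z≤n) 3≤n)) in
      injection⇒≤∣p∣ k (boundary 0) start start-injective start-∈
    large (suc j) j<n = let open Linkage (linked j j<n) in
      injection⇒≤∣p∣ k (boundary (suc j)) end end-injective end-∈

  linked-boundaries : ∀ j → j < n → DisjointPaths G (slab j) k (boundary j) (boundary (suc j))
  linked-boundaries j j<n = start , end , (λ i → proj₁ (path i)) ,
    (λ i → proj₁ (proj₂ (path i)) , start-∈ i , end-∈ i) ,
    (λ i i′ i≢i′ x x∈ x∈′ → i≢i′ (disjoint i i′ (proj₂ (proj₂ (path i)) x∈) (proj₂ (proj₂ (path i′)) x∈′)))
    where
    L = linked j j<n
    open Linkage L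
    path : ∀ i → ∃ λ vs → PathIn G (slab j) (start i) (end i) vs × (∀ {x} → x ∈ₗ vs → x ∈ₗ verts i)
    path i = erase-loops (proj₂ (Slab.route-walk j (route i) (Slab.start-∈V j L i)))

  cover-vertex : ∀ v → ∃ λ i → v ∈ V (part i)
  cover-vertex v with outer-or-level v
  ... | inj₁ o = zero , ∈-compr⁺ Outer? o
  ... | inj₂ (_ , j , j<n , v∈ , v∉) = suc (fromℕ< j<n) ,
    subst (λ i → v ∈ V (slab i)) (sym (Finₚ.toℕ-fromℕ< j<n)) (Slab.∈V⁺ j (inj₁ (v∈ , v∉)))

  cover-edge : ∀ e → ∃ λ i → e ∈ E (part i)
  cover-edge e with InSlabEdge? e
  ... | yes (j , e∈) = suc j , e∈
  ... | no  ¬slab    = zero , ∈-compr⁺ (λ e → ¬? (InSlabEdge? e)) ¬slab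

  ring-decomposition : RingDecomposition G k n
  ring-decomposition = record
    { n≥3 = 3≤n ; part = part ; unionV = cover-vertex ; unionE = cover-edge
    ; consecEdgeDisjoint = consec ; nonconsecVertexDisjoint = nonconsec
    ; sizeW = λ i → trans (cong ∣_∣ (common≡boundary i)) (boundary-size (toℕ i) (Finₚ.toℕ≤pred[n] i))
    ; linked = λ j → subst₂ (DisjointPaths G (slab (toℕ j)) k)
        (trans (cong boundary (sym (Finₚ.toℕ-inject₁ j))) (sym (common≡boundary (inject₁ j))))
        (sym (common≡boundary (suc j)))
        (linked-boundaries (toℕ j) (Finₚ.toℕ<n j)) }

  ring-connected : ConnectedRing ring-decomposition
  ring-connected j = connected (toℕ j) (Finₚ.toℕ<n j)

-- Thinning a chain of connected sets to a family

-- Bridges `degree`, a list length, and the cardinalities of subsets.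
∣compr∣≤length-filter : ∀ {n} {P : Fin n → Set} (P? : Decidable P) → ∣ compr P? ∣ ≤ length (filter P? (allFin n))
∣compr∣≤length-filter P? = ≤-trans
  (cover-bound (compr P?) (filter P? (allFin _)) ⁅_⁆ (λ x _ → ≤-reflexive (∣⁅x⁆∣≡1 x))
    (λ {y} y∈ → y , ∈-filter⁺ P? (∈-allFin y) (∈-compr⁻ P? y∈) , x∈⁅x⁆ y))
  (≤-reflexive (*-identityʳ _))

-- The power of T with exponent q: each refinement passes to one of T rungs.
thin : ℕ → ℕ → ℕ
thin T zero    = 1
thin T (suc q) = T * thin T q

thin>0 : ∀ {T} → 1 ≤ T → ∀ q → 1 ≤ thin T q
thin>0 1≤T zero    = ≤-refl
thin>0 1≤T (suc q) = *-mono-≤ 1≤T (thin>0 1≤T q)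

module _ (G : Multigraph) where

  Full : Subset (nV G)
  Full = Subset.⊤

  N : Subset (nV G) → Subset (nV G)
  N = ∂ G Full

  Incident? : ∀ v → Decidable (λ e → src G e ≡ v ⊎ tgt G e ≡ v)
  Incident? v e = (src G e Fin.≟ v) ⊎-dec (tgt G e Fin.≟ v)

  incident : Fin (nV G) → Subset (nE G)
  incident v = compr (Incident? v)

  ∣incident∣≤ : ∀ {d} → MaxDegree≤ G d → ∀ v → ∣ incident v ∣ ≤ d
  ∣incident∣≤ deg v = ≤-trans (∣compr∣≤length-filter (Incident? v)) (deg v)

  Crosses : Subset (nV G) → Fin (nE G) → Set
  Crosses X e = (src G e ∈ X × tgt G e ∉ X) ⊎ (tgt G e ∈ X × src G e ∉ X)

  Crosses? : ∀ X → Decidable (Crosses X)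
  Crosses? X e = ((src G e ∈? X) ×-dec ¬? (tgt G e ∈? X)) ⊎-dec ((tgt G e ∈? X) ×-dec ¬? (src G e ∈? X))

  crosses⁺ : ∀ {X e x y} → Joins G e x y → x ∉ X → y ∈ X → Crosses X e
  crosses⁺ (inj₁ (refl , refl)) x∉ y∈ = inj₂ (y∈ , x∉)
  crosses⁺ (inj₂ (refl , refl)) x∉ y∈ = inj₁ (y∈ , x∉)

  crosses⁻ : ∀ {X e} → Crosses X e → ∃₂ λ x y → Joins G e x y × x ∉ X × y ∈ X
  crosses⁻ (inj₁ (s∈ , t∉)) = _ , _ , inj₂ (refl , refl) , t∉ , s∈
  crosses⁻ (inj₂ (t∈ , s∉)) = _ , _ , inj₁ (refl , refl) , s∉ , t∈

  crosses-out : ∀ {X e x y} → Joins G e x y → Crosses X e → y ∈ X → x ∉ X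
  crosses-out (inj₁ (refl , refl)) (inj₁ (_ , t∉)) y∈ = ⊥-elim (t∉ y∈)
  crosses-out (inj₁ (refl , refl)) (inj₂ (_ , s∉)) y∈ = s∉
  crosses-out (inj₂ (refl , refl)) (inj₁ (_ , t∉)) y∈ = t∉
  crosses-out (inj₂ (refl , refl)) (inj₂ (_ , s∉)) y∈ = ⊥-elim (s∉ y∈)

  crosses-in : ∀ {X e x y} → Joins G e x y → Crosses X e → x ∉ X → y ∈ X
  crosses-in (inj₁ (refl , refl)) (inj₁ (s∈ , _)) x∉ = ⊥-elim (x∉ s∈)
  crosses-in (inj₁ (refl , refl)) (inj₂ (t∈ , _)) x∉ = t∈
  crosses-in (inj₂ (refl , refl)) (inj₁ (s∈ , _)) x∉ = s∈
  crosses-in (inj₂ (refl , refl)) (inj₂ (t∈ , _)) x∉ = ⊥-elim (x∉ t∈)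

  -- The inner end of such an edge lies in Y and its outer end outside X.
  crosses-between : ∀ {X Y W e} → Y ⊆ W → W ⊆ X → Crosses X e → Crosses Y e → Crosses W e
  crosses-between Y⊆W W⊆X cX cY with crosses⁻ cY
  ... | x , y , j , x∉Y , y∈Y = crosses⁺ j (crosses-out j cX (W⊆X (Y⊆W y∈Y)) ∘ W⊆X) (Y⊆W y∈Y)

  δ : Subset (nV G) → Subset (nE G)
  δ X = compr (Crosses? X)

  -- Every crossing edge is incident with its outer end, a vertex of `N X`.
  ∣δ∣≤ : ∀ {d w} → MaxDegree≤ G d → ∀ X → ∣ N X ∣ ≤ w → ∣ δ X ∣ ≤ w * d
  ∣δ∣≤ {d} {w} deg X NX≤w = ≤-trans
    (cover-bound (δ X) (elements (N X)) incident (λ v _ → ∣incident∣≤ deg v) covered)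
    (*-monoˡ-≤ d (≤-trans (≤-reflexive (length-elements (N X))) NX≤w))
    where
    end : ∀ {e x y} → Joins G e x y → src G e ≡ x ⊎ tgt G e ≡ x
    end (inj₁ (s , _)) = inj₁ s
    end (inj₂ (_ , t)) = inj₂ t
    covered : ∀ {e} → e ∈ δ X → ∃ λ v → v ∈ₗ elements (N X) × e ∈ incident v
    covered {e} e∈ with crosses⁻ (∈-compr⁻ (Crosses? X) e∈)
    ... | x , y , j , x∉ , y∈ = x , ∈-elements (∈∂⁺ G ∈⊤ x∉ y∈ (e , j)) , ∈-compr⁺ (Incident? x) (end j)

  ConnectedSet : Subset (nV G) → Set
  ConnectedSet C = ∀ {x y} → x ∈ C → y ∈ C → Conn G (_∈ C) (λ _ → ⊤) x y

  record Chain (Z : ℕ → Subset (nV G)) (m w : ℕ) : Set where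
    field
      nest      : ∀ j → Z (suc j) ⊆ Z j
      strict    : ∀ j → j < m → ∃ λ x → x ∈ Z j × x ∉ Z (suc j)
      connected : ∀ j → j ≤ m → ConnectedSet (Z j)
      nonempty  : ∃ λ x → x ∈ Z m
      order     : ∀ j → j ≤ m → ∣ N (Z j) ∣ ≤ w

    nested : ∀ {i j} → i ≤ j → Z j ⊆ Z i
    nested {i} {zero}  z≤n = id
    nested {i} {suc j} i≤ with m≤n⇒m<n∨m≡n i≤
    ... | inj₁ i<   = nested (≤-pred i<) ∘ nest j
    ... | inj₂ refl = id

  module Thinning {Z m w} (C : Chain Z m w) (T D : ℕ) (1≤T : 1 ≤ T) (δ≤D : ∀ j → j ≤ m → ∣ δ (Z j) ∣ ≤ D) where
    open Chain C

    persistent : ℕ → ℕ → Subset (nE G)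
    persistent i j = δ (Z i) ∩ δ (Z j)

    ∈persistent⁺ : ∀ {i j e} → Crosses (Z i) e → Crosses (Z j) e → e ∈ persistent i j
    ∈persistent⁺ c c′ = x∈p∩q⁺ (∈-compr⁺ (Crosses? _) c , ∈-compr⁺ (Crosses? _) c′)

    ∈persistent⁻ : ∀ {i j e} → e ∈ persistent i j → Crosses (Z i) e × Crosses (Z j) e
    ∈persistent⁻ {i} {j} e∈ = let a , b = x∈p∩q⁻ (δ (Z i)) (δ (Z j)) e∈ in
      ∈-compr⁻ (Crosses? _) a , ∈-compr⁻ (Crosses? _) b

    persistent-mono : ∀ {a i j b} → a ≤ i → i ≤ j → j ≤ b → persistent a b ⊆ persistent i j
    persistent-mono a≤i i≤j j≤b e∈ = let ca , cb = ∈persistent⁻ e∈ in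
      ∈persistent⁺ (crosses-between (nested (≤-trans i≤j j≤b)) (nested a≤i) ca cb)
                   (crosses-between (nested j≤b) (nested (≤-trans a≤i i≤j)) ca cb)

    -- The equally spaced subchain that is sought: an edge crossing two consecutive sets of it
    -- crosses the first and the last one.
    Spread : ℕ → ℕ → Set
    Spread c M = ladder c M T ≤ m × 1 ≤ M ×
      (∀ i → i < T → persistent (ladder c M i) (ladder c M (suc i)) ⊆ persistent c (ladder c M T))

    -- An edge crossing one rung but not the whole ladder is a new
    -- persistent edge for that rung, and there are at most D in all.
    spread : ∀ q c → thin T q + c ≤ m → D < ∣ persistent c (thin T q + c) ∣ + q → ∃₂ Spread
    spread zero c bound D< = ⊥-elim (<-irrefl refl (<-≤-trans D< (≤-trans (≤-reflexive (+-identityʳ _))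
      (≤-trans (∣p∩q∣≤∣p∣ (δ (Z c)) _) (δ≤D c (≤-trans (m≤n+m c 1) bound))))))
    spread (suc q) c bound D< with Finₚ.any? {n = T} (λ i → Finₚ.any? (λ e →
        (e ∈? persistent (ladder c (thin T q) (toℕ i)) (ladder c (thin T q) (suc (toℕ i))))
        ×-dec ¬? (e ∈? persistent c (ladder c (thin T q) T))))
    ... | no none = c , M , subst (_≤ m) (sym (ladder≡ c M T)) bound , thin>0 1≤T q , λ i i<T {e} e∈ →
        decidable-stable (e ∈? persistent c (ladder c M T)) (λ e∉ → none (fromℕ< i<T , e ,
          subst (λ i → e ∈ persistent (ladder c M i) (ladder c M (suc i))) (sym (Finₚ.toℕ-fromℕ< i<T)) e∈ , e∉))
      where M = thin T q
    ... | yes (i , e , e∈ , e∉) = spread q (ladder c M (toℕ i)) (≤-trans top bound′)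
          (<-≤-trans D< (≤-trans (≤-reflexive (+-suc _ q)) (+-monoˡ-≤ q
            (subst (λ b → ∣ persistent c b ∣ < ∣ persistent (ladder c M (toℕ i)) (ladder c M (suc (toℕ i))) ∣)
              (ladder≡ c M T) more))))
      where
      M = thin T q
      top : ladder c M (suc (toℕ i)) ≤ ladder c M T
      top = ladder-mono c M (Finₚ.toℕ<n i)
      bound′ : ladder c M T ≤ m
      bound′ = subst (_≤ m) (sym (ladder≡ c M T)) bound
      more : ∣ persistent c (ladder c M T) ∣ < ∣ persistent (ladder c M (toℕ i)) (ladder c M (suc (toℕ i))) ∣
      more = p⊂q⇒∣p∣<∣q∣
        (persistent-mono (ladder-mono c M {0} {toℕ i} z≤n) (m≤n+m _ M) top , e , e∈ , e∉)

    spread⇒family : ∀ {c M} → Spread c M → Family G (Z ∘ ladder c M) T w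
    spread⇒family {c} {M} (top , 1≤M , persists) = record
      { nest  = λ j → nested (m≤n+m _ M)
      ; ring  = ring
      ; order = λ j _ j≤T → ≤-trans
          (p⊆q⇒∣p∣≤∣q∣ (λ x∈ → let _ , x∉ , y , y∈ , a = ∈∂⁻ G x∈ in ∈∂⁺ G ∈⊤ x∉ y∈ a))
          (order (ladder c M j) (≤-trans (ladder-mono c M j≤T) top))
      ; cut   = cut }
      where
      ring : ∀ {x y} j → j < T → Adj G x y → x ∉ Z (ladder c M j) → y ∈ Z (ladder c M (suc j)) →
        x ∉ Z c × y ∈ Z (ladder c M T)
      ring {x} {y} j j<T (e , J) x∉ y∈ with ∈persistent⁻ (persists j j<T
        (∈persistent⁺ (crosses⁺ J x∉ (nested (m≤n+m _ M) y∈)) (crosses⁺ J (x∉ ∘ nested (m≤n+m _ M)) y∈)))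
      ... | first , last = crosses-out J first (nested (ladder-mono c M {0} {suc j} z≤n) y∈) ,
                           crosses-in J last (x∉ ∘ nested (ladder-mono c M (<⇒≤ j<T)))
      c<m : c < m
      c<m = ≤-trans (+-monoˡ-≤ c 1≤M) (≤-trans (ladder-mono c M 1≤T) top)
      cut : ∀ W → Z (ladder c M T) ⊆ W → W ⊆ Z (M + c) → ∃ λ x → x ∈ ∂ G (Z c) W
      -- W misses a vertex of `Z c` by strictness and contains a vertex of the last set, so the
      -- connected set `Z c` has an edge entering W.
      cut W T⊆W W⊆1 with strict c c<m | nonempty
      ... | x₀ , x₀∈ , x₀∉ | y₀ , y₀∈ with ∼-crossing W (connected c (<⇒≤ c<m) x₀∈ (nested (<⇒≤ c<m) y₀∈))
                                            (x₀∉ ∘ nested (+-monoˡ-≤ c 1≤M) ∘ W⊆1) (T⊆W (nested top y₀∈))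
      ...   | x , y , p , a , x∉ , y∈ = x , ∈∂⁺ G (∼-target p) x∉ y∈ a

    family : thin T (suc D) ≤ m → ∃ λ Y → Family G Y T w
    -- With q = D + 1 the counting hypothesis of `spread` holds for any number of persistent edges.
    family bound = let c , M , s = spread (suc D) 0 (≤-trans (≤-reflexive (+-identityʳ _)) bound) (m≤n+m (suc D) _) in
      _ , spread⇒family s

-- Chains from tree-decompositions

module TreeChain (G : Multigraph) {w d : ℕ} (conn : Connected G) (TD : TreeDecomposition G w)
  (deg : MaxDegree≤ G d) where

  open TreeDecomposition TD

  shared-bag : ∀ {e x y} → Joins G e x y → ∃ λ r → x ∈ bag r × y ∈ bag r
  shared-bag {e} (inj₁ (refl , refl)) = coversE e
  shared-bag {e} (inj₂ (refl , refl)) = let r , a , b = coversE e in r , b , a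

  module Entering {C : Subset (nV G)} (C-conn : ConnectedSet G C) where

    Meets : Fin (nV T) → Set
    Meets s = ∃ λ c → c ∈ C × c ∈ bag s

    Meets? : Decidable Meets
    Meets? s = Finₚ.any? (λ c → (c ∈? C) ×-dec (c ∈? bag s))

    -- The subtrees of consecutive vertices of the walk share a node, and all their nodes meet C.
    walk-meets : ∀ {c c′ vs es s s′} → Walk G (_∈ C) (λ _ → ⊤) c c′ vs es → c ∈ bag s → c′ ∈ bag s′ →
      Conn T Meets (λ _ → ⊤) s s′
    walk-meets {c} {s = s} {s′} (stop c∈) c∈s c∈s′ =
      ∼-map (λ c∈t → c , c∈ , c∈t) (λ _ _ _ _ → id) (proj₂ (subtree c) s s′ c∈s c∈s′)
    walk-meets {c} {s = s} (step e c∈ _ j p) c∈s c′∈s′ with shared-bag j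
    ... | r , c∈r , c₁∈r = ∼-trans
      (∼-map (λ c∈t → c , c∈ , c∈t) (λ _ _ _ _ → id) (proj₂ (subtree c) s r c∈s c∈r))
      (walk-meets p c₁∈r c′∈s′)

    avoids : ∀ {P : Fin (nV T) → Set} {e a b u v} → Joins T e a b → ¬ P a →
      Conn T P (λ _ → ⊤) u v → Conn T (λ _ → ⊤) (λ e′ → e ≢ e′) u v
    avoids {P} {e} {a} J ¬Pa = ∼-map _
      (λ { e′ Px Py j _ refl → [ (λ { refl → ¬Pa Px }) , (λ { refl → ¬Pa Py }) ]′ (Joins-ends {T} j J) })

    -- If y were missing from the bag at b, the walk from a back to t, on
    -- through the subtree of y, and then through the nodes meeting C to b
    -- would bypass the edge ab of the tree.
    entering-bag : ∀ {t e a b} → Conn T (λ s → ¬ Meets s) (λ _ → ⊤) t a → Joins T e a b → Meets b →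
      N G C ⊆ bag t → N G C ⊆ bag b
    entering-bag {t} {e} {a} {b} t∼a J (c , c∈C , c∈b) N⊆t {y} y∈N = decidable-stable (y ∈? bag b) λ y∉b →
      proj₂ isTree (bypass⇒cycle J
        (∼-trans (avoids (Joins-sym {T} J) (λ ¬meets → ¬meets (c , c∈C , c∈b)) (∼-sym t∼a))
        (∼-trans (avoids (Joins-sym {T} J) y∉b (proj₂ (subtree y) t s (N⊆t y∈N) y∈s))
                 (avoids J (∼-target t∼a) (walk-meets (proj₂ (proj₂ (C-conn c′∈C c∈C))) c′∈s c∈b)))))
      where
      near = proj₂ (proj₂ (∈∂⁻ G y∈N))
      c′ = proj₁ near
      c′∈C = proj₁ (proj₂ near)
      common = shared-bag (proj₂ (proj₂ (proj₂ near)))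
      s = proj₁ common
      y∈s = proj₁ (proj₂ common)
      c′∈s = proj₂ (proj₂ common)

    -- The tree is followed from t towards C up to the first bag meeting C. Its vertex in C improves
    -- the bound on the neighbours from w + 1 to w, and makes the next set of the chain strictly
    -- smaller.
    entering : ∀ {c} → c ∈ C → ∀ t → N G C ⊆ bag t → ∃ λ b → Meets b × N G C ⊆ bag b
    entering {c} c∈C t N⊆t with Meets? t
    ... | yes meets = t , meets , N⊆t
    ... | no ¬meets with coversV c
    ...   | r , c∈r with proj₂ (proj₁ isTree) t r tt tt
    ...     | _ , _ , p with walk-first-entry (compr Meets?) p (¬meets ∘ ∈-compr⁻ Meets?) (∈-compr⁺ Meets? (c , c∈C , c∈r))
    ...       | a , b , e , t∼a , _ , J , b∈ = b , ∈-compr⁻ Meets? b∈ ,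
      entering-bag (∼-map (λ (_ , ∉M) → ∉M ∘ ∈-compr⁺ Meets?) (λ _ _ _ _ → id) t∼a) J (∈-compr⁻ Meets? b∈) N⊆t

    neighbours≤w : ∀ b → Meets b → N G C ⊆ bag b → ∣ N G C ∣ ≤ w
    neighbours≤w b (c , c∈C , c∈b) N⊆b = ≤-pred (<-≤-trans
      (p⊂q⇒∣p∣<∣q∣ (N⊆b , c , c∈b , λ c∈N → proj₁ (proj₂ (∈∂⁻ G c∈N)) c∈C)) (width≤ b))

  module Splitting {C X : Subset (nV G)} (C-conn : ConnectedSet G C) (N⊆X : N G C ⊆ X)
    {c₀ : Fin (nV G)} (c₀∈C : c₀ ∈ C) (c₀∈X : c₀ ∈ X) where

    P : Fin (nV G) → Set
    P v = v ∈ C × v ∉ X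

    P? : Decidable P
    P? v = (v ∈? C) ×-dec ¬? (v ∈? X)

    infix 4 _∼′_
    _∼′_ : Fin (nV G) → Fin (nV G) → Set
    _∼′_ = Conn G P (λ _ → ⊤)

    _∼′?_ : ∀ u v → Dec (u ∼′ v)
    u ∼′? v = u ∼?[ P? , (λ _ → yes tt) ] v

    -- The component of z in C minus X, empty if z does not lie there.
    K : Fin (nV G) → Subset (nV G)
    K z = compr (z ∼′?_)

    ∈K⁺ : ∀ z {x} → z ∼′ x → x ∈ K z
    ∈K⁺ z = ∈-compr⁺ (z ∼′?_)

    ∈K⁻ : ∀ z {x} → x ∈ K z → z ∼′ x
    ∈K⁻ z = ∈-compr⁻ (z ∼′?_)

    K⊆C : ∀ z → K z ⊆ C
    K⊆C z x∈ = proj₁ (∼-target (∈K⁻ z x∈))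

    c₀∉K : ∀ z → c₀ ∉ K z
    c₀∉K z c₀∈K = proj₂ (∼-target (∈K⁻ z c₀∈K)) c₀∈X

    K-connected : ∀ z → ConnectedSet G (K z)
    K-connected z x∈ y∈ = ∼-map (∈K⁺ z) (λ _ _ _ _ → id)
      (∼-reached (∈K⁻ z x∈) (∼-trans (∼-sym (∈K⁻ z x∈)) (∈K⁻ z y∈)))

    -- A neighbour in C but outside X would belong to the component; one outside C is a neighbour of
    -- C.
    N-K : ∀ z → N G (K z) ⊆ X
    N-K z {x} x∈ with ∈∂⁻ G x∈
    ... | _ , x∉K , y , y∈K , a@(e , j) with x ∈? C | x ∈? X
    ... | _       | yes x∈X = x∈X
    ... | yes x∈C | no x∉X  = ⊥-elim (x∉K (∈K⁺ z (∼-snoc e (∈K⁻ z y∈K) tt (Joins-sym {G} j) (x∈C , x∉X))))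
    ... | no x∉C  | no _    = N⊆X (∈∂⁺ G ∈⊤ x∉C (K⊆C z y∈K) a)

    Touching? : Decidable (λ e → ∃ λ x → x ∈ X × (src G e ≡ x ⊎ tgt G e ≡ x))
    Touching? e = Finₚ.any? (λ x → (x ∈? X) ×-dec Incident? G x e)

    touching : Subset (nE G)
    touching = compr Touching?

    ∣touching∣≤ : ∣ touching ∣ ≤ ∣ X ∣ * d
    ∣touching∣≤ = ≤-trans
      (cover-bound touching (elements X) (incident G) (λ v _ → ∣incident∣≤ G deg v)
        (λ e∈ → let x , x∈ , inc = ∈-compr⁻ Touching? e∈ in x , ∈-elements x∈ , ∈-compr⁺ (Incident? G x) inc))
      (*-monoˡ-≤ d (≤-reflexive (length-elements X)))

    -- A walk in C from y to c₀ first enters X along an edge whose other end is in the component of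
    -- y. Both ends are allowed, as edges carry no preferred direction, so each edge touching X
    -- accounts for at most two components.
    reached-from-X : ∀ {y} → Conn G (_∈ C) (λ _ → ⊤) y c₀ → y ∉ X →
      ∃ λ e → e ∈ touching × y ∈ K (src G e) ∪ K (tgt G e)
    reached-from-X (_ , _ , p) y∉X with walk-first-entry X p y∉X c₀∈X
    ... | z , x , e , y∼z , _ , j , x∈X with j
    ...   | inj₁ (refl , refl) = e , ∈-compr⁺ Touching? (x , x∈X , inj₂ refl) , x∈p∪q⁺ (inj₁ (∈K⁺ z (∼-sym y∼z)))
    ...   | inj₂ (refl , refl) = e , ∈-compr⁺ Touching? (x , x∈X , inj₁ refl) , x∈p∪q⁺ (inj₂ (∈K⁺ z (∼-sym y∼z)))

    ∣C∣≤ : ∀ g → (∀ z → ∣ K z ∣ ≤ g) → ∣ C ∣ ≤ ∣ X ∣ + (∣ X ∣ * d) * (g + g)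
    ∣C∣≤ g K≤g = ≤-trans (p⊆q⇒∣p∣≤∣q∣ C⊆)
      (≤-trans (∣p∪q∣≤∣p∣+∣q∣ X (compr P?)) (+-monoʳ-≤ ∣ X ∣ (≤-trans
        (cover-bound (compr P?) (elements touching) (λ e → K (src G e) ∪ K (tgt G e))
          (λ e _ → ≤-trans (∣p∪q∣≤∣p∣+∣q∣ (K (src G e)) (K (tgt G e))) (+-mono-≤ (K≤g (src G e)) (K≤g (tgt G e))))
          (λ y∈ → let y∈C , y∉X = ∈-compr⁻ P? y∈ ; e , e∈ , y∈K = reached-from-X (C-conn y∈C c₀∈C) y∉X
                  in e , ∈-elements e∈ , y∈K))
        (*-monoˡ-≤ (g + g) (≤-trans (≤-reflexive (length-elements touching)) ∣touching∣≤)))))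
      where
      C⊆ : C ⊆ X ∪ compr P?
      C⊆ {x} x∈C with x ∈? X
      ... | yes x∈X = x∈p∪q⁺ (inj₁ x∈X)
      ... | no  x∉X = x∈p∪q⁺ (inj₂ (∈-compr⁺ P? (x∈C , x∉X)))

    big-component : ∀ g → ∣ X ∣ + (∣ X ∣ * d) * (g + g) < ∣ C ∣ → ∃ λ z → g ≤ ∣ K z ∣
    big-component g big with Finₚ.any? (λ z → g ≤? ∣ K z ∣)
    ... | yes found = found
    ... | no none = ⊥-elim (<-irrefl refl (<-≤-trans big (∣C∣≤ g (λ z → <⇒≤ (≰⇒> (λ g≤ → none (z , g≤)))))))

-- A bag has at most w + 1 vertices, touched by at most (w + 1) d edges with two components each.
-- The outer successor gives the strict inequality of `big-component`.
chain-size : ℕ → ℕ → ℕ → ℕ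
chain-size w d zero    = 1
chain-size w d (suc m) = suc (suc w + (suc w * d) * (chain-size w d m + chain-size w d m))

chain-size>0 : ∀ w d m → 1 ≤ chain-size w d m
chain-size>0 w d zero    = ≤-refl
chain-size>0 w d (suc m) = s≤s z≤n

nonempty : ∀ {n} (p : Subset n) → 1 ≤ ∣ p ∣ → ∃ λ x → x ∈ p
nonempty p 1≤ = enumerate p (Fin.inject≤ {1} zero 1≤) , enumerate-∈ p _

module _ (G : Multigraph) {w d : ℕ} (conn : Connected G) (TD : TreeDecomposition G w) (deg : MaxDegree≤ G d) where

  open TreeDecomposition TD
  open TreeChain G conn TD deg

  -- The next set is a large component of C minus the bag at b. Its neighbours lie in that bag, so b
  -- takes the place of t; the equation for `Z 0` allows C to be put in front.
  chain-from : ∀ m C → ConnectedSet G C → ∀ t → N G C ⊆ bag t → chain-size w d m ≤ ∣ C ∣ →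
    ∃ λ Z → Z 0 ≡ C × Chain G Z m w
  chain-from m C C-conn t N⊆t big with nonempty C (≤-trans (chain-size>0 w d m) big)
  ... | c , c∈C with Entering.entering C-conn c∈C t N⊆t
  ... | b , meets@(c₀ , c₀∈C , c₀∈b) , N⊆b = build m big
    where
    open Splitting C-conn N⊆b c₀∈C c₀∈b
    N≤w : ∣ N G C ∣ ≤ w
    N≤w = Entering.neighbours≤w C-conn b meets N⊆b
    build : ∀ m → chain-size w d m ≤ ∣ C ∣ → ∃ λ Z → Z 0 ≡ C × Chain G Z m w
    build zero _ = (λ _ → C) , refl , record
      { nest = λ _ → id ; strict = λ _ () ; connected = λ _ _ → C-conn ; nonempty = c , c∈C
      ; order = λ _ _ → N≤w }
    build (suc m) big with big-component (chain-size w d m) (≤-trans (s≤s (+-mono-≤ (width≤ b)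
        (*-monoˡ-≤ (chain-size w d m + chain-size w d m) (*-monoˡ-≤ d (width≤ b))))) big)
    ... | z , big-K with chain-from m (K z) (K-connected z) b (N-K z) big-K
    ... | Z , Z0≡K , chain = Z′ , refl , record
      { nest = λ { zero → Z0⊆C ; (suc j) → Chain.nest chain j }
      ; strict = λ { zero _ → c₀ , c₀∈C , c₀∉K z ∘ subst (c₀ ∈_) Z0≡K ; (suc j) (s≤s j<m) → Chain.strict chain j j<m }
      ; connected = λ { zero _ → C-conn ; (suc j) (s≤s j≤m) → Chain.connected chain j j≤m }
      ; nonempty = Chain.nonempty chain
      ; order = λ { zero _ → N≤w ; (suc j) (s≤s j≤m) → Chain.order chain j j≤m } }
      where
      Z′ : ℕ → Subset (nV G)
      Z′ zero    = C
      Z′ (suc j) = Z j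
      Z0⊆C : Z 0 ⊆ C
      Z0⊆C {x} = K⊆C z ∘ subst (x ∈_) Z0≡K

  chain : ∀ m → chain-size w d m ≤ nV G → ∃ λ Z → Chain G Z m w
  chain m big =
    let t , _ = proj₁ (proj₁ isTree)
        Z , _ , C = chain-from m (Full G)
          (λ {x} {y} _ _ → ∼-map (λ _ → ∈⊤) (λ _ _ _ _ → id) (proj₂ conn x y tt tt)) t
          -- The full vertex set has no outer neighbours, so any bag can be the first.
          (λ x∈ → ⊥-elim (proj₁ (proj₂ (∈∂⁻ G x∈)) ∈⊤)) (≤-trans big (≤-reflexive (sym (∣⊤∣≡n (nV G)))))
    in Z , C

theorem6p1 : Σ (ℕ → ℕ → ℕ → ℕ) λ f →
    ∀ (n w d : ℕ) → 3 ≤ n → 1 ≤ w → 1 ≤ d →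
    ∀ (G : Multigraph) → Connected G → TreeWidth≤ G w → MaxDegree≤ G d → f n w d ≤ nV G →
    ∃ λ w′ → ∃ λ len → w′ ≤ w × n ≤ len × Σ (RingDecomposition G w′ len) ConnectedRing
theorem6p1 = (λ n w d → chain-size w d (links n w d)) , λ n w d 3≤n _ _ G conn TD deg big →
  let Z , C     = chain G conn TD deg (links n w d) big
      -- At most w outer neighbours of degree at most d bound each edge cut by `w * d`, which takes
      -- the role of D.
      Y , F     = Thinning.family G C (family-length w n) (w * d) (family-length>0 w n)
                    (λ j j≤m → ∣δ∣≤ G deg (Z j) (Chain.order C j j≤m)) ≤-refl
      k , k≤w , R = linked-family G conn w n Y F
  in k , n , k≤w , ≤-refl , Assembly.ring-decomposition G 3≤n R , Assembly.ring-connected G 3≤n R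
  where
  links : ℕ → ℕ → ℕ → ℕ
  links n w d = thin (family-length w n) (suc (w * d))
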